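{- Let $n\ge 2$ and let $w\in S_n$ be the permutation whose one-line notation is $w=(1,2,n-1,n,n-3,n-2,\ldots)$, namely $w=(1,2,n-1,n,n-3,n-2,\ldots,3,4)$ if $n$ is even and $w=(1,2,n-1,n,n-3,n-2,\ldots,4,5,3)$ if $n$ is odd. Then \[\Phi_w=\begin{cases} C_{k-1}^2 & \text{if } n=2k \text{ is even},\\ C_{k-1}C_k & \text{if } n=2k+1 \text{ is odd},\end{cases}\] where $C_k=\frac{(2k)!}{k!\,(k+1)!}$ is the $k$-th Catalan number.
   Context: For $w\in S_n$, $\mathfrak{S}_w$ denotes the Schubert polynomial of $w$, and $\Phi_w:=\left|\mathfrak{S}_w(1,q,q^2,\ldots)\right|_{q=-1}=\left|\mathfrak{S}_w(1,-1,1,-1,\ldots)\right|$, i.e. the absolute value of $\mathfrak{S}_w$ evaluated at $x_i=(-1)^{i-1}$. In the paper's notation this $w$ is the doubly layered permutation $w_2(2,n-2)$. -}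

module Defs where

open import Data.Nat using (ℕ; zero; suc; _+_; _*_; _∸_; _^_; _<ᵇ_; _/_; _!)
open import Data.Nat.Properties using (_!*_!≢0)
open import Data.Bool using (Bool; true; false; if_then_else_)
open import Data.Integer as ℤ using (ℤ; ∣_∣)
open import Data.List using (List; []; _∷_; _++_; map; length; upTo; concatMap; sum)
open import Data.Maybe using (Maybe; nothing; just)
open import Data.Product using (_×_; _,_)

catalan : ℕ → ℕ
catalan k = ((2 * k) ! / (k ! * (suc k) !)) {{k !* (suc k) !≢0}}

-- Permutations in one-line notation (lists of values 1..n)

at : List ℕ → ℕ → ℕ
at []       _       = 0
at (x ∷ xs) zero    = x
at (x ∷ xs) (suc i) = at xs i

-- swap the entries at 0-based positions i and i+1  (w ↦ w s_{i+1})
swapAt : ℕ → List ℕ → List ℕ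
swapAt zero    (x ∷ y ∷ xs) = y ∷ x ∷ xs
swapAt (suc i) (x ∷ xs)     = x ∷ swapAt i xs
swapAt _       xs           = xs

sucM : Maybe ℕ → Maybe ℕ
sucM nothing  = nothing
sucM (just i) = just (suc i)

firstAscent : List ℕ → Maybe ℕ
firstAscent (x ∷ y ∷ xs) = if x <ᵇ y then just 0 else sucM (firstAscent (y ∷ xs))
firstAscent _ = nothing

-- Polynomials in ℤ[x_1,...,x_n] as formal ℤ-linear combinations of
-- monomials; a monomial is its exponent list (a_1,...,a_n).

Poly : Set
Poly = List (ℤ × List ℕ)

setAt : ℕ → ℕ → List ℕ → List ℕ
setAt zero    v (_ ∷ xs) = v ∷ xs
setAt (suc i) v (x ∷ xs) = x ∷ setAt i v xs
setAt _       _ []       = []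

set2 : ℕ → ℕ → ℕ → List ℕ → List ℕ
set2 i p q e = setAt (suc i) q (setAt i p e)

-- divided difference ∂_{i+1} (0-based i: acts on variables x_{i+1}, x_{i+2})
-- on the monomial c·x^e:  (f - s f)/(x_{i+1} - x_{i+2}).
-- With a = e(i), b = e(i+1):
--   a > b :  c · Σ_{j<a-b} x_{i+1}^{a-1-j} x_{i+2}^{b+j}
--   a = b :  0
--   a < b : -c · Σ_{j<b-a} x_{i+1}^{b-1-j} x_{i+2}^{a+j}
ddMono : ℕ → ℤ × List ℕ → Poly
ddMono i (c , e) with at e (suc i) <ᵇ at e i | at e i <ᵇ at e (suc i)
... | true  | _     = map (λ j → c , set2 i (a ∸ suc j) (b + j) e) (upTo (a ∸ b))
  where a = at e i ; b = at e (suc i)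
... | false | true  = map (λ j → ℤ.- c , set2 i (b ∸ suc j) (a + j) e) (upTo (b ∸ a))
  where a = at e i ; b = at e (suc i)
... | false | false = []

dd : ℕ → Poly → Poly
dd i p = concatMap (ddMono i) p

staircase : ℕ → List ℕ
staircase n = map (λ i → n ∸ suc i) (upTo n)

-- Schubert polynomials via divided differences:
--   S_{w₀} = x^δ ;  S_w = ∂_i S_{w s_i}  whenever w(i) < w(i+1).
-- We always use the first ascent; each step raises the length by one,
-- so the fuel n*n ≥ n(n-1)/2 is never exhausted for w ∈ S_n.
schubFuel : ℕ → ℕ → List ℕ → Poly
schubFuel zero     n w = []
schubFuel (suc f)  n w with firstAscent w
... | nothing = (ℤ.+ 1 , staircase n) ∷ []
... | just i  = dd i (schubFuel f n (swapAt i w))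

schubert : List ℕ → Poly
schubert w = schubFuel (length w * length w) (length w) w

powℤ : ℤ → ℕ → ℤ
powℤ x zero    = ℤ.+ 1
powℤ x (suc k) = x ℤ.* powℤ x k

-- evaluate a monomial at a point x (x i = value of x_{i+1})
evalMono : (ℕ → ℤ) → List ℕ → ℤ
evalMono x e = go 0 e
  where
  go : ℕ → List ℕ → ℤ
  go _ []       = ℤ.+ 1
  go i (a ∷ as) = powℤ (x i) a ℤ.* go (suc i) as

evalPoly : (ℕ → ℤ) → Poly → ℤ
evalPoly x []             = ℤ.+ 0
evalPoly x ((c , e) ∷ ps) = c ℤ.* evalMono x e ℤ.+ evalPoly x ps

altPoint : ℕ → ℤ
altPoint i = powℤ (ℤ.- (ℤ.+ 1)) i

Φ : List ℕ → ℕ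
Φ w = ∣ evalPoly altPoint (schubert w) ∣

wTail : ℕ → List ℕ
wTail (suc (suc (suc (suc m)))) = (3 + m) ∷ (4 + m) ∷ wTail (suc (suc m))
wTail (suc (suc (suc zero)))    = 3 ∷ []
wTail _                         = []

wPerm : ℕ → List ℕ
wPerm n = 1 ∷ 2 ∷ wTail n

{-# OPTIONS --safe #-}
module Submission where

-- Sorting w by first ascents gives 𝔖_w = ∂₁ F_n with F_n = 𝔖 of (2,1,n-1,n,n-3,n-2,…) and
--   F_{m+2} = ∂₂ ∂₁ ∂₃ ∂₂ ∂₁ (x₁^{m+1} x₂^m F_m(x₃,x₄,…)).
-- The operators touch only x₁,…,x₄, so one may put (x₅,x₆,…) = (1,-1,…) at once and follow
-- f_m(x,y) = F_m(x,y,1,-1,…).  Up to sign, f_m(x,y) - f_m(y,x) is the wedge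
-- u(x)w(y) - u(y)w(x) of two univariate polynomials of opposite parity: restricting the
-- antisymmetrisation over four variables to (x,y,1,-1) splits it into an even and an odd factor,
-- and each of u, w evolves by p ↦ (x^k p(1) - p(x)) / (x² - 1), where k = m or m + 1 is the
-- exponent with the parity of p.  In powers of x² this map takes
-- partial sums of coefficients, so the coefficients are ballot numbers and the values at 1 are
-- Catalan numbers.

open import Defs
open import Data.Bool using (true; false; T; if_then_else_)
open import Data.Integer using (ℤ; +_; _+_; _*_; _-_; -_; 0ℤ; 1ℤ; -1ℤ; ∣_∣; ≢-nonZero)
import Data.Integer.Properties as ℤ
open import Data.Integer.Tactic.RingSolver using (solve-∀)
open import Data.List using (List; []; _∷_; _++_; map; length; upTo; applyUpTo)
open import Data.List.Properties using (map-upTo; map-∘; map-++; ++-identityʳ)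
open import Data.List.Relation.Unary.All as All using (All; []; _∷_)
open import Data.List.Relation.Unary.All.Properties using (map⁺; ++⁺)
open import Data.Maybe using (Maybe; just; nothing)
open import Data.Nat as ℕ using (ℕ; zero; suc; _!; _≤_; _<_; z≤n; s≤s; _<ᵇ_; _∸_; ⌊_/2⌋)
open import Data.Nat.DivMod using (m*n/n≡m; /-congˡ)
import Data.Nat.Properties as ℕ
import Data.Nat.Tactic.RingSolver as ℕ-Solver
open import Data.Product using (_×_; _,_; ∃-syntax; proj₁; proj₂)
open import Data.Unit using (tt)
open import Function using (_∘_; id)
open import Relation.Binary.PropositionalEquality
open import Relation.Nullary using (contradiction)
open ≡-Reasoning

-- Polynomials as functions on integer points


Point : Set
Point = ℕ → ℤ

mon : Point → List ℕ → ℤ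
mon x []      = 1ℤ
mon x (a ∷ e) = powℤ (x 0) a * mon (x ∘ suc) e

ev : Point → Poly → ℤ
ev x []            = 0ℤ
ev x ((c , e) ∷ p) = c * mon x e + ev x p

mon-cong : ∀ {x y} → (∀ i → x i ≡ y i) → ∀ e → mon x e ≡ mon y e
mon-cong x≗y []      = refl
mon-cong x≗y (a ∷ e) =
  cong₂ _*_ (cong (λ z → powℤ z a) (x≗y 0)) (mon-cong (x≗y ∘ suc) e)

ev-cong : ∀ {x y} → (∀ i → x i ≡ y i) → ∀ p → ev x p ≡ ev y p
ev-cong x≗y []            = refl
ev-cong x≗y ((c , e) ∷ p) = cong₂ _+_ (cong (c *_) (mon-cong x≗y e)) (ev-cong x≗y p)

-- The local function of evalMono cannot be named here; abstracting its
-- arguments in evalMono≡mon lets unification fill it in for the underscore.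
mutual
  go≡mon : ∀ x e₀ i e → _ ≡ mon (λ j → x (j ℕ.+ i)) e
  go≡mon x e₀ i []      = refl
  go≡mon x e₀ i (a ∷ e) = cong (powℤ (x i) a *_)
    (trans (go≡mon x e₀ (suc i) e) (mon-cong (λ j → cong x (ℕ.+-suc j i)) e))

  evalMono≡mon : ∀ x e → evalMono x e ≡ mon x e
  evalMono≡mon x [] = refl
  evalMono≡mon x (a ∷ e) with suc zero in eq | a ∷ e
  ... | i | e₀ = cong (powℤ (x 0) a *_) (trans (go≡mon x e₀ i e)
    (mon-cong (λ j → cong x (trans (cong (j ℕ.+_) (sym eq)) (ℕ.+-comm j 1))) e))

evalPoly≡ev : ∀ x p → evalPoly x p ≡ ev x p
evalPoly≡ev x []            = refl
evalPoly≡ev x ((c , e) ∷ p) = cong₂ _+_ (cong (c *_) (evalMono≡mon x e)) (evalPoly≡ev x p)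

ev-++ : ∀ x p q → ev x (p ++ q) ≡ ev x p + ev x q
ev-++ x []            q = sym (ℤ.+-identityˡ _)
ev-++ x ((c , e) ∷ p) q =
  trans (cong (_+_ (c * mon x e)) (ev-++ x p q)) (sym (ℤ.+-assoc (c * mon x e) _ _))

infixr 5 _◂_
_◂_ : ℤ → Point → Point
(a ◂ x) zero    = a
(a ◂ x) (suc i) = x i

-- Divided differences as difference quotients

swapPt : ℕ → Point → Point
swapPt zero    x = x 1 ◂ x 0 ◂ x ∘ suc ∘ suc
swapPt (suc i) x = x 0 ◂ swapPt i (x ∘ suc)

cons : ℕ → ℤ × List ℕ → ℤ × List ℕ
cons a (c , e) = c , a ∷ e

ev-cons : ∀ x a p → ev x (map (cons a) p) ≡ powℤ (x 0) a * ev (x ∘ suc) p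
ev-cons x a []            = sym (ℤ.*-zeroʳ (powℤ (x 0) a))
ev-cons x a ((c , e) ∷ p) = trans (cong (_+_ (c * (powℤ (x 0) a * mon (x ∘ suc) e))) (ev-cons x a p))
  (lem c (powℤ (x 0) a) (mon (x ∘ suc) e) (ev (x ∘ suc) p))
  where
  lem : ∀ c u m r → c * (u * m) + u * r ≡ u * (c * m + r)
  lem = solve-∀

ddMono-cons : ∀ i a m → ddMono (suc i) (cons a m) ≡ map (cons a) (ddMono i m)
ddMono-cons i a (c , e) with at e (suc i) <ᵇ at e i | at e i <ᵇ at e (suc i)
... | true  | _     = map-∘ (upTo (at e i ∸ at e (suc i)))
... | false | true  = map-∘ (upTo (at e (suc i) ∸ at e i))
... | false | false = refl

-- Divided differences from the second variable on never look at the first exponent, so a power of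
-- x₁ passes through them. The equality holds for lists of terms, not only for values, and can thus
-- be used inside the chain of first ascents.
dd-cons : ∀ i a p → dd (suc i) (map (cons a) p) ≡ map (cons a) (dd i p)
dd-cons i a []      = refl
dd-cons i a (m ∷ p) = trans (cong₂ _++_ (ddMono-cons i a m) (dd-cons i a p))
  (sym (map-++ (cons a) (ddMono i m) (dd i p)))

telescope : ∀ (d : ℤ) x (f : ℕ → ℤ × List ℕ) (t : ℕ → ℤ) n →
  (∀ j → j < n → d * ev x (f j ∷ []) ≡ t j - t (suc j)) →
  d * ev x (applyUpTo f n) ≡ t 0 - t n
telescope d x f t zero    h = trans (ℤ.*-zeroʳ d) (sym (ℤ.+-inverseʳ (t 0)))
telescope d x f t (suc n) h = begin
  d * ev x (f 0 ∷ applyUpTo (f ∘ suc) n)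
    ≡⟨ cong (d *_) (ev-++ x (f 0 ∷ []) (applyUpTo (f ∘ suc) n)) ⟩
  d * (ev x (f 0 ∷ []) + ev x (applyUpTo (f ∘ suc) n))
    ≡⟨ ℤ.*-distribˡ-+ d (ev x (f 0 ∷ [])) _ ⟩
  d * ev x (f 0 ∷ []) + d * ev x (applyUpTo (f ∘ suc) n)
    ≡⟨ cong₂ _+_ (h 0 (s≤s z≤n)) (telescope d x (f ∘ suc) (t ∘ suc) n (λ j j<n → h (suc j) (s≤s j<n))) ⟩
  (t 0 - t 1) + (t 1 - t (suc n))
    ≡⟨ lem (t 0) (t 1) (t (suc n)) ⟩
  t 0 - t (suc n) ∎
  where
  lem : ∀ u v w → (u - v) + (v - w) ≡ u - w
  lem = solve-∀

-- Multiplication by x₁ - x₂ turns the j-th term of the sum into c x₁^(p-j) x₂^(q+j) minus the same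
-- expression at j + 1, so the sum telescopes.
geometric : ∀ x c p q e → q ≤ p →
  (x 0 - x 1) * ev x (map (λ j → c , p ∸ suc j ∷ q ℕ.+ j ∷ e) (upTo (p ∸ q)))
    ≡ c * mon x (p ∷ q ∷ e) - c * mon x (q ∷ p ∷ e)
geometric x c p q e q≤p = begin
  (x 0 - x 1) * ev x (map f (upTo (p ∸ q)))
    ≡⟨ cong (λ l → (x 0 - x 1) * ev x l) (map-upTo f (p ∸ q)) ⟩
  (x 0 - x 1) * ev x (applyUpTo f (p ∸ q))
    ≡⟨ telescope (x 0 - x 1) x f t (p ∸ q) step ⟩
  t 0 - t (p ∸ q)
    ≡⟨ cong₂ (λ u v → c * mon x u - c * mon x v)
         (cong (λ r → p ∷ r ∷ e) (ℕ.+-identityʳ q))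
         (cong₂ (λ r s → r ∷ s ∷ e) (ℕ.m∸[m∸n]≡n q≤p) (ℕ.m+[n∸m]≡n q≤p)) ⟩
  c * mon x (p ∷ q ∷ e) - c * mon x (q ∷ p ∷ e) ∎
  where
  f : ℕ → ℤ × List ℕ
  f j = c , p ∸ suc j ∷ q ℕ.+ j ∷ e
  t : ℕ → ℤ
  t j = c * mon x (p ∸ j ∷ q ℕ.+ j ∷ e)
  lem : ∀ c u v a b r → (u - v) * (c * (a * (b * r)) + 0ℤ) ≡ c * ((u * a) * (b * r)) - c * (a * ((v * b) * r))
  lem = solve-∀
  step : ∀ j → j < p ∸ q → (x 0 - x 1) * ev x (f j ∷ []) ≡ t j - t (suc j)
  -- Since j < p - q ≤ p, the exponent p - j is a successor and `powℤ` releases the factor x₁.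
  step j j<p∸q rewrite ℕ.+-suc q j | sym (ℕ.suc-pred (p ∸ j) {{ℕ.>-nonZero (ℕ.m<n⇒0<n∸m (ℕ.<-≤-trans j<p∸q (ℕ.m∸n≤m p q)))}})
    | ℕ.pred[m∸n]≡m∸[1+n] p j = lem c (x 0) (x 1) (powℤ (x 0) (p ∸ suc j)) (powℤ (x 1) (q ℕ.+ j)) (mon (x ∘ suc ∘ suc) e)

-- The list has to reach position i + 1: beyond its end `at` reads 0 but `setAt` writes nothing, so
-- powers of the second variable would be lost. `Long` carries this condition through iterated
-- operators.
ddMono-ev : ∀ i x c e → suc (suc i) ≤ length e →
  (x i - x (suc i)) * ev x (ddMono i (c , e)) ≡ c * mon x e - c * mon (swapPt i x) e
ddMono-ev zero x c (a ∷ []) (s≤s ())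
ddMono-ev zero x c (a ∷ b ∷ e) _ with b <ᵇ a in b<a | a <ᵇ b in a<b
... | true  | _     = trans (geometric x c a b e (ℕ.<⇒≤ (ℕ.<ᵇ⇒< b a (subst T (sym b<a) tt))))
  (lem c (powℤ (x 0) a) (powℤ (x 1) b) (powℤ (x 0) b) (powℤ (x 1) a) (mon (x ∘ suc ∘ suc) e))
  where
  lem : ∀ c u v w z r → c * (u * (v * r)) - c * (w * (z * r)) ≡ c * (u * (v * r)) - c * (z * (w * r))
  lem = solve-∀
... | false | true  = trans (geometric x (- c) b a e (ℕ.<⇒≤ (ℕ.<ᵇ⇒< a b (subst T (sym a<b) tt))))
  (lem c (powℤ (x 0) a) (powℤ (x 1) b) (powℤ (x 0) b) (powℤ (x 1) a) (mon (x ∘ suc ∘ suc) e))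
  where
  lem : ∀ c u v w z r → (- c) * (w * (z * r)) - (- c) * (u * (v * r)) ≡ c * (u * (v * r)) - c * (z * (w * r))
  lem = solve-∀
... | false | false with ℕ.≤-antisym {a} {b} (ℕ.≮⇒≥ (λ p → subst T b<a (ℕ.<⇒<ᵇ p))) (ℕ.≮⇒≥ (λ p → subst T a<b (ℕ.<⇒<ᵇ p)))
...   | refl = lem (x 0) (x 1) c (powℤ (x 0) a) (powℤ (x 1) a) (mon (x ∘ suc ∘ suc) e)
  where
  lem : ∀ s t c u v r → (s - t) * 0ℤ ≡ c * (u * (v * r)) - c * (v * (u * r))
  lem = solve-∀
ddMono-ev (suc i) x c (a ∷ e) (s≤s i<e) = begin
  (x (suc i) - x (suc (suc i))) * ev x (ddMono (suc i) (c , a ∷ e))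
    ≡⟨ cong (λ l → (x (suc i) - x (suc (suc i))) * l) (trans (cong (ev x) (ddMono-cons i a (c , e))) (ev-cons x a (ddMono i (c , e)))) ⟩
  (x (suc i) - x (suc (suc i))) * (powℤ (x 0) a * ev (x ∘ suc) (ddMono i (c , e)))
    ≡⟨ lem₁ (x (suc i) - x (suc (suc i))) (powℤ (x 0) a) (ev (x ∘ suc) (ddMono i (c , e))) ⟩
  powℤ (x 0) a * ((x (suc i) - x (suc (suc i))) * ev (x ∘ suc) (ddMono i (c , e)))
    ≡⟨ cong (powℤ (x 0) a *_) (ddMono-ev i (x ∘ suc) c e i<e) ⟩
  powℤ (x 0) a * (c * mon (x ∘ suc) e - c * mon (swapPt i (x ∘ suc)) e)
    ≡⟨ lem₂ (powℤ (x 0) a) c _ _ ⟩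
  c * mon x (a ∷ e) - c * mon (swapPt (suc i) x) (a ∷ e) ∎
  where
  lem₁ : ∀ d u r → d * (u * r) ≡ u * (d * r)
  lem₁ = solve-∀
  lem₂ : ∀ u c m n → u * (c * m - c * n) ≡ c * (u * m) - c * (u * n)
  lem₂ = solve-∀

Long : ℕ → Poly → Set
Long n = All (λ m → n ≤ length (proj₂ m))

dd-ev : ∀ i x p → Long (suc (suc i)) p →
  (x i - x (suc i)) * ev x (dd i p) ≡ ev x p - ev (swapPt i x) p
dd-ev i x []            []      = ℤ.*-zeroʳ (x i - x (suc i))
dd-ev i x ((c , e) ∷ p) (l ∷ ls) = begin
  (x i - x (suc i)) * ev x (ddMono i (c , e) ++ dd i p)
    ≡⟨ cong ((x i - x (suc i)) *_) (ev-++ x (ddMono i (c , e)) (dd i p)) ⟩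
  (x i - x (suc i)) * (ev x (ddMono i (c , e)) + ev x (dd i p))
    ≡⟨ ℤ.*-distribˡ-+ (x i - x (suc i)) (ev x (ddMono i (c , e))) _ ⟩
  (x i - x (suc i)) * ev x (ddMono i (c , e)) + (x i - x (suc i)) * ev x (dd i p)
    ≡⟨ cong₂ _+_ (ddMono-ev i x c e l) (dd-ev i x p ls) ⟩
  (c * mon x e - c * mon (swapPt i x) e) + (ev x p - ev (swapPt i x) p)
    ≡⟨ lem (c * mon x e) (c * mon (swapPt i x) e) (ev x p) (ev (swapPt i x) p) ⟩
  (c * mon x e + ev x p) - (c * mon (swapPt i x) e + ev (swapPt i x) p) ∎
  where
  lem : ∀ u v r s → (u - v) + (r - s) ≡ (u + r) - (v + s)
  lem = solve-∀

length-setAt : ∀ i v e → length (setAt i v e) ≡ length e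
length-setAt zero    v []      = refl
length-setAt zero    v (_ ∷ e) = refl
length-setAt (suc i) v []      = refl
length-setAt (suc i) v (_ ∷ e) = cong suc (length-setAt i v e)

length-set2 : ∀ i p q e → length (set2 i p q e) ≡ length e
length-set2 i p q e = trans (length-setAt (suc i) q (setAt i p e)) (length-setAt i p e)

ddMono-long : ∀ n i c e → n ≤ length e → Long n (ddMono i (c , e))
ddMono-long n i c e n≤ with at e (suc i) <ᵇ at e i | at e i <ᵇ at e (suc i)
... | true  | _     = map⁺ (All.universal (λ j → subst (n ≤_) (sym (length-set2 i _ _ e)) n≤) _)
... | false | true  = map⁺ (All.universal (λ j → subst (n ≤_) (sym (length-set2 i _ _ e)) n≤) _)
... | false | false = []

dd-long : ∀ n i p → Long n p → Long n (dd i p)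
dd-long n i []            []       = []
dd-long n i ((c , e) ∷ p) (l ∷ ls) = ++⁺ (ddMono-long n i c e l) (dd-long n i p ls)

cons-long : ∀ n a p → Long n p → Long (suc n) (map (cons a) p)
cons-long n a []      []       = []
cons-long n a (m ∷ p) (l ∷ ls) = s≤s l ∷ cons-long n a p ls

-- The chain of first ascents


-- The product of the monomial x^u with p, the variables of p being shifted past those of u.
pre : List ℕ → Poly → Poly
pre []      p = p
pre (a ∷ u) p = map (cons a) (pre u p)

pre-++ : ∀ u v p → pre (u ++ v) p ≡ pre u (pre v p)
pre-++ []      v p = refl
pre-++ (a ∷ u) v p = cong (map (cons a)) (pre-++ u v p)

pre-singleton : ∀ u c e → pre u ((c , e) ∷ []) ≡ (c , u ++ e) ∷ []
pre-singleton []      c e = refl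
pre-singleton (a ∷ u) c e = cong (map (cons a)) (pre-singleton u c e)

-- Used in two roles: as the initial decreasing run of a permutation and, with m lowered by one, as
-- the staircase exponents at the same positions.
desc : ℕ → ℕ → List ℕ
desc zero    m = []
desc (suc d) m = suc (d ℕ.+ m) ∷ desc d m

desc-snoc : ∀ d m l → desc (suc d) m ++ l ≡ desc d (suc m) ++ suc m ∷ l
desc-snoc zero    m l = refl
desc-snoc (suc d) m l = cong₂ _∷_ (cong suc (sym (ℕ.+-suc d m))) (desc-snoc d m l)

desc-snoc₂ : ∀ d m l → desc (suc (suc d)) m ++ l ≡ desc d (suc (suc m)) ++ suc (suc m) ∷ suc m ∷ l
desc-snoc₂ d m l = trans (desc-snoc (suc d) m l) (desc-snoc d (suc m) (suc m ∷ l))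

dd-desc : ∀ d m i p → dd (d ℕ.+ i) (pre (desc d m) p) ≡ pre (desc d m) (dd i p)
dd-desc zero    m i p = refl
dd-desc (suc d) m i p = trans (dd-cons (d ℕ.+ i) _ (pre (desc d m) p)) (cong (map (cons _)) (dd-desc d m i p))

swapAt-desc : ∀ d m i l → swapAt (d ℕ.+ i) (desc d m ++ l) ≡ desc d m ++ swapAt i l
swapAt-desc zero    m i l = refl
swapAt-desc (suc d) m i l = cong (_ ∷_) (swapAt-desc d m i l)

≤⇒≮ᵇ : ∀ {m n} → n ≤ m → (m <ᵇ n) ≡ false
≤⇒≮ᵇ z≤n       = refl
≤⇒≮ᵇ (s≤s n≤m) = ≤⇒≮ᵇ n≤m

n<ᵇ1+n : ∀ n → (n <ᵇ suc n) ≡ true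
n<ᵇ1+n zero    = refl
n<ᵇ1+n (suc n) = n<ᵇ1+n n

sucM^ : ℕ → Maybe ℕ → Maybe ℕ
sucM^ zero    r = r
sucM^ (suc d) r = sucM (sucM^ d r)

sucM^-just : ∀ d i → sucM^ d (just i) ≡ just (d ℕ.+ i)
sucM^-just zero    i = refl
sucM^-just (suc d) i = cong sucM (sucM^-just d i)

sucM^-nothing : ∀ d → sucM^ d nothing ≡ nothing
sucM^-nothing zero    = refl
sucM^-nothing (suc d) = cong sucM (sucM^-nothing d)

-- All entries of the run exceed m ≥ x, so there is no ascent inside it or at its end.
firstAscent-desc : ∀ d m x l → x ≤ m → firstAscent (desc d m ++ x ∷ l) ≡ sucM^ d (firstAscent (x ∷ l))
firstAscent-desc zero          m x l x≤m = refl
firstAscent-desc (suc zero)    m x l x≤m =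
  cong (λ b → if b then just 0 else sucM (firstAscent (x ∷ l))) (≤⇒≮ᵇ (ℕ.m≤n⇒m≤1+n x≤m))
firstAscent-desc (suc (suc d)) m x l x≤m =
  cong₂ (λ b r → if b then just 0 else sucM r) (≤⇒≮ᵇ (ℕ.n≤1+n (suc (d ℕ.+ m)))) (firstAscent-desc (suc d) m x l x≤m)

schubFuel-step : ∀ f n w i → firstAscent w ≡ just i → schubFuel (suc f) n w ≡ dd i (schubFuel f n (swapAt i w))
schubFuel-step f n w i eq rewrite eq = refl

schubFuel-stop : ∀ f n w → firstAscent w ≡ nothing → schubFuel (suc f) n w ≡ (+ 1 , staircase n) ∷ []
schubFuel-stop f n w eq rewrite eq = refl

step-desc : ∀ f n d m x l i → x ≤ m → firstAscent (x ∷ l) ≡ just i →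
  schubFuel (suc f) n (desc d m ++ x ∷ l) ≡ dd (d ℕ.+ i) (schubFuel f n (desc d m ++ swapAt i (x ∷ l)))
step-desc f n d m x l i x≤m eq = trans
  (schubFuel-step f n (desc d m ++ x ∷ l) (d ℕ.+ i)
    (trans (firstAscent-desc d m x l x≤m) (trans (cong (sucM^ d) eq) (sucM^-just d i))))
  (cong (λ w → dd (d ℕ.+ i) (schubFuel f n w)) (swapAt-desc d m i (x ∷ l)))

staircase-suc : ∀ n → staircase (suc n) ≡ n ∷ staircase n
staircase-suc n = trans (map-upTo (λ i → suc n ∸ suc i) (suc n))
  (cong (n ∷_) (sym (map-upTo (λ i → n ∸ suc i) n)))

staircase-desc : ∀ d m → staircase (d ℕ.+ suc m) ≡ desc d m ++ staircase (suc m)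
staircase-desc zero    m = refl
staircase-desc (suc d) m = trans (staircase-suc (d ℕ.+ suc m)) (cong₂ _∷_ (ℕ.+-suc d m) (staircase-desc d m))

stop-desc : ∀ f d m l → firstAscent (suc m ∷ l) ≡ nothing →
  schubFuel (suc f) (d ℕ.+ suc m) (desc d (suc m) ++ suc m ∷ l) ≡ pre (desc d m) ((+ 1 , staircase (suc m)) ∷ [])
stop-desc f d m l eq = trans
  (schubFuel-stop f (d ℕ.+ suc m) (desc d (suc m) ++ suc m ∷ l)
    (trans (firstAscent-desc d (suc m) (suc m) l ℕ.≤-refl) (trans (cong (sucM^ d) eq) (sucM^-nothing d))))
  (trans (cong (λ e → (+ 1 , e) ∷ []) (staircase-desc d m)) (sym (pre-singleton (desc d m) (+ 1) (staircase (suc m)))))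

-- These are the five first-ascent swaps that take 2, 1, a, b with 2 < a < b to b, a, 2, 1; the
-- outermost operator belongs to the first swap.
dd₅ : Poly → Poly
dd₅ p = dd 1 (dd 0 (dd 2 (dd 1 (dd 0 p))))

-- schub₂₁ j is the Schubert polynomial of (2,1,n-1,n,n-3,n-2,…) for n = j + 2.
schub₂₁ : ℕ → Poly
schub₂₁ zero          = (+ 1 , 1 ∷ 0 ∷ []) ∷ []
schub₂₁ (suc zero)    = dd 1 (dd 0 ((+ 1 , 2 ∷ 1 ∷ 0 ∷ []) ∷ []))
schub₂₁ (suc (suc j)) = dd₅ (pre (3 ℕ.+ j ∷ 2 ℕ.+ j ∷ []) (schub₂₁ j))

-- One unit per swap, and one more for the last call, which returns the staircase monomial.
fuel : ℕ → ℕ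
fuel zero          = 1
fuel (suc zero)    = 3
fuel (suc (suc j)) = 5 ℕ.+ fuel j

-- The prefix is there for the induction: five swaps bring the two largest remaining values in front
-- of 2, 1, where they extend the decreasing run, and what follows is the same problem for d + 2 and
-- a smaller j. The surplus f absorbs unspent fuel.
schubFuel-schub₂₁ : ∀ j d f →
  schubFuel (fuel j ℕ.+ f) (d ℕ.+ (2 ℕ.+ j)) (desc d (2 ℕ.+ j) ++ 2 ∷ 1 ∷ wTail (2 ℕ.+ j))
    ≡ pre (desc d (1 ℕ.+ j)) (schub₂₁ j)
schubFuel-schub₂₁ zero d f = stop-desc f d 1 (1 ∷ []) refl
schubFuel-schub₂₁ (suc zero) d f = begin
  schubFuel (3 ℕ.+ f) n (desc d 3 ++ 2 ∷ 1 ∷ 3 ∷ [])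
    ≡⟨ step-desc (2 ℕ.+ f) n d 3 2 (1 ∷ 3 ∷ []) 1 (s≤s (s≤s z≤n)) refl ⟩
  dd (d ℕ.+ 1) (schubFuel (2 ℕ.+ f) n (desc d 3 ++ 2 ∷ 3 ∷ 1 ∷ []))
    ≡⟨ cong (dd (d ℕ.+ 1)) (step-desc (1 ℕ.+ f) n d 3 2 (3 ∷ 1 ∷ []) 0 (s≤s (s≤s z≤n)) refl) ⟩
  dd (d ℕ.+ 1) (dd (d ℕ.+ 0) (schubFuel (1 ℕ.+ f) n (desc d 3 ++ 3 ∷ 2 ∷ 1 ∷ [])))
    ≡⟨ cong (dd (d ℕ.+ 1) ∘ dd (d ℕ.+ 0)) (stop-desc f d 2 (2 ∷ 1 ∷ []) refl) ⟩
  dd (d ℕ.+ 1) (dd (d ℕ.+ 0) (pre (desc d 2) q))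
    ≡⟨ cong (dd (d ℕ.+ 1)) (dd-desc d 2 0 q) ⟩
  dd (d ℕ.+ 1) (pre (desc d 2) (dd 0 q))
    ≡⟨ dd-desc d 2 1 (dd 0 q) ⟩
  pre (desc d 2) (schub₂₁ 1) ∎
  where
  n : ℕ
  n = d ℕ.+ 3
  q : Poly
  q = (+ 1 , 2 ∷ 1 ∷ 0 ∷ []) ∷ []
schubFuel-schub₂₁ (suc (suc j)) d f = begin
  S 5 (2 ∷ 1 ∷ a ∷ b ∷ t)
    ≡⟨ step-desc _ n d b 2 (1 ∷ a ∷ b ∷ t) 1 (s≤s (s≤s z≤n)) refl ⟩
  D 1 (S 4 (2 ∷ a ∷ 1 ∷ b ∷ t))
    ≡⟨ cong (D 1) (step-desc _ n d b 2 (a ∷ 1 ∷ b ∷ t) 0 (s≤s (s≤s z≤n)) refl) ⟩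
  D 1 (D 0 (S 3 (a ∷ 2 ∷ 1 ∷ b ∷ t)))
    ≡⟨ cong (D 1 ∘ D 0) (step-desc _ n d b a (2 ∷ 1 ∷ b ∷ t) 2 (ℕ.n≤1+n a) refl) ⟩
  D 1 (D 0 (D 2 (S 2 (a ∷ 2 ∷ b ∷ 1 ∷ t))))
    ≡⟨ cong (D 1 ∘ D 0 ∘ D 2) (step-desc _ n d b a (2 ∷ b ∷ 1 ∷ t) 1 (ℕ.n≤1+n a) refl) ⟩
  D 1 (D 0 (D 2 (D 1 (S 1 (a ∷ b ∷ 2 ∷ 1 ∷ t)))))
    ≡⟨ cong (D 1 ∘ D 0 ∘ D 2 ∘ D 1) (step-desc _ n d b a (b ∷ 2 ∷ 1 ∷ t) 0 (ℕ.n≤1+n a) a<b) ⟩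
  D 1 (D 0 (D 2 (D 1 (D 0 (S 0 (b ∷ a ∷ 2 ∷ 1 ∷ t))))))
    ≡⟨ cong (D 1 ∘ D 0 ∘ D 2 ∘ D 1 ∘ D 0) rec ⟩
  D 1 (D 0 (D 2 (D 1 (D 0 (pre u q)))))
    ≡⟨ cong (D 1 ∘ D 0 ∘ D 2 ∘ D 1) (dd-desc d (3 ℕ.+ j) 0 q) ⟩
  D 1 (D 0 (D 2 (D 1 (pre u (dd 0 q)))))
    ≡⟨ cong (D 1 ∘ D 0 ∘ D 2) (dd-desc d (3 ℕ.+ j) 1 _) ⟩
  D 1 (D 0 (D 2 (pre u (dd 1 (dd 0 q)))))
    ≡⟨ cong (D 1 ∘ D 0) (dd-desc d (3 ℕ.+ j) 2 _) ⟩
  D 1 (D 0 (pre u (dd 2 (dd 1 (dd 0 q)))))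
    ≡⟨ cong (D 1) (dd-desc d (3 ℕ.+ j) 0 _) ⟩
  D 1 (pre u (dd 0 (dd 2 (dd 1 (dd 0 q)))))
    ≡⟨ dd-desc d (3 ℕ.+ j) 1 _ ⟩
  pre u (dd₅ q) ∎
  where
  a b n : ℕ
  a = 3 ℕ.+ j
  b = 4 ℕ.+ j
  n = d ℕ.+ b
  t u : List ℕ
  t = wTail (2 ℕ.+ j)
  u = desc d (3 ℕ.+ j)
  q : Poly
  q = pre (3 ℕ.+ j ∷ 2 ℕ.+ j ∷ []) (schub₂₁ j)
  D : ℕ → Poly → Poly
  D i = dd (d ℕ.+ i)
  S : ℕ → List ℕ → Poly
  S k l = schubFuel (k ℕ.+ (fuel j ℕ.+ f)) n (desc d b ++ l)
  a<b : firstAscent (a ∷ b ∷ 2 ∷ 1 ∷ t) ≡ just 0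
  a<b rewrite n<ᵇ1+n j = refl
  n≡ : n ≡ suc (suc d) ℕ.+ (2 ℕ.+ j)
  n≡ = trans (ℕ.+-suc d (3 ℕ.+ j)) (cong suc (ℕ.+-suc d (2 ℕ.+ j)))
  rec : S 0 (b ∷ a ∷ 2 ∷ 1 ∷ t) ≡ pre u q
  -- The values b and a join the run; the staircase exponents at their positions, 3 + j and 2 + j,
  -- are split off again to form q.
  rec = begin
    schubFuel (fuel j ℕ.+ f) n (desc d b ++ b ∷ a ∷ 2 ∷ 1 ∷ t)
      ≡⟨ cong₂ (schubFuel (fuel j ℕ.+ f)) n≡ (sym (desc-snoc₂ d (2 ℕ.+ j) (2 ∷ 1 ∷ t))) ⟩
    schubFuel (fuel j ℕ.+ f) (suc (suc d) ℕ.+ (2 ℕ.+ j)) (desc (suc (suc d)) (2 ℕ.+ j) ++ 2 ∷ 1 ∷ t)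
      ≡⟨ schubFuel-schub₂₁ j (suc (suc d)) f ⟩
    pre (desc (suc (suc d)) (1 ℕ.+ j)) (schub₂₁ j)
      ≡⟨ cong (λ v → pre v (schub₂₁ j)) (trans (sym (++-identityʳ _)) (desc-snoc₂ d (1 ℕ.+ j) [])) ⟩
    pre (u ++ 3 ℕ.+ j ∷ 2 ℕ.+ j ∷ []) (schub₂₁ j)
      ≡⟨ pre-++ u (3 ℕ.+ j ∷ 2 ℕ.+ j ∷ []) (schub₂₁ j) ⟩
    pre u q ∎

length-wTail : ∀ j → length (wTail (2 ℕ.+ j)) ≡ j
length-wTail zero          = refl
length-wTail (suc zero)    = refl
length-wTail (suc (suc j)) = cong (suc ∘ suc) (length-wTail j)

-- The successor pays for the initial swap of 1 and 2 in `wPerm`.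
fuel-bound : ∀ j → suc (fuel j) ≤ (2 ℕ.+ j) ℕ.* (2 ℕ.+ j)
fuel-bound zero          = s≤s (s≤s z≤n)
fuel-bound (suc zero)    = s≤s (s≤s (s≤s (s≤s z≤n)))
fuel-bound (suc (suc j)) = ℕ.≤-trans (ℕ.+-monoʳ-≤ 5 (fuel-bound j))
  -- (4 + j)² - (2 + j)² = 12 + 4j, of which the five new swaps leave 7 + 4j.
  (ℕ.≤-trans (ℕ.m≤m+n _ (7 ℕ.+ 4 ℕ.* j)) (ℕ.≤-reflexive (lem j)))
  where
  lem : ∀ j → 5 ℕ.+ (2 ℕ.+ j) ℕ.* (2 ℕ.+ j) ℕ.+ (7 ℕ.+ 4 ℕ.* j) ≡ (4 ℕ.+ j) ℕ.* (4 ℕ.+ j)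
  lem = ℕ-Solver.solve-∀

schubert-wPerm : ∀ j → schubert (wPerm (2 ℕ.+ j)) ≡ dd 0 (schub₂₁ j)
schubert-wPerm j with ℕ.m≤n⇒∃[o]m+o≡n (fuel-bound j)
... | f , eq = begin
  schubert (wPerm (2 ℕ.+ j))
    ≡⟨ cong (λ n → schubFuel (n ℕ.* n) n (wPerm (2 ℕ.+ j))) (cong (suc ∘ suc) (length-wTail j)) ⟩
  schubFuel ((2 ℕ.+ j) ℕ.* (2 ℕ.+ j)) (2 ℕ.+ j) (wPerm (2 ℕ.+ j))
    ≡⟨ cong (λ k → schubFuel k (2 ℕ.+ j) (wPerm (2 ℕ.+ j))) (sym eq) ⟩
  dd 0 (schubFuel (fuel j ℕ.+ f) (2 ℕ.+ j) (2 ∷ 1 ∷ wTail (2 ℕ.+ j)))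
    ≡⟨ cong (dd 0) (schubFuel-schub₂₁ j 0 f) ⟩
  dd 0 (schub₂₁ j) ∎

ddMono-gap₁ : ∀ m c e → ddMono 0 (c , suc m ∷ m ∷ e) ≡ (c , m ∷ m ∷ e) ∷ []
ddMono-gap₁ m c e rewrite n<ᵇ1+n m | ℕ.m+n∸n≡m 1 m | ℕ.+-identityʳ m = refl

-- The exponents differ by one, so each quotient is a single term. The innermost operator of `dd₅`
-- thus leaves the symmetric factor x₁^m x₂^m, and only four operators remain.
dd-gap₁ : ∀ m p → dd 0 (pre (suc m ∷ m ∷ []) p) ≡ pre (m ∷ m ∷ []) p
dd-gap₁ m []            = refl
dd-gap₁ m ((c , e) ∷ p) = cong₂ _++_ (ddMono-gap₁ m c e) (dd-gap₁ m p)

-- Divided differences on four variables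


-- This removes the cleared denominators and is the source of the inequality hypotheses below, which
-- `cp-unique` lifts later.
cancel-difference : ∀ {a b u v} → a ≢ b → (a - b) * u ≡ (a - b) * v → u ≡ v
cancel-difference {a} {b} {u} {v} a≢b = ℤ.*-cancelˡ-≡ (a - b) u v {{≢-nonZero (a≢b ∘ ℤ.i-j≡0⇒i≡j a b)}}

-- The functions r, s, v, F are the successive values of ∂₂, ∂₃ ∂₂, ∂₁ ∂₃ ∂₂, ∂₂ ∂₁ ∂₃ ∂₂ applied to
-- p(x₁) p(x₂) f(x₃,x₄), recorded by their defining equations with the denominators cleared.
module SixTerm
  (p : ℤ → ℤ) (f : ℤ → ℤ → ℤ) (r s v F : ℤ → ℤ → ℤ → ℤ → ℤ)
  (r-eq : ∀ a b c d → (b - c) * r a b c d ≡ p a * (p b * f c d) - p a * (p c * f b d))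
  (s-eq : ∀ a b c d → (c - d) * s a b c d ≡ r a b c d - r a b d c)
  (v-eq : ∀ a b c d → (a - b) * v a b c d ≡ s a b c d - s b a c d)
  (F-eq : ∀ a b c d → (b - c) * F a b c d ≡ v a b c d - v a c b d)
  where

  alt : ℤ → ℤ → ℤ
  alt x y = f x y - f y x

  s-cleared : ∀ a b c d → (b - c) * ((b - d) * ((c - d) * s a b c d)) ≡
    (b - d) * (p a * (p b * f c d) - p a * (p c * f b d)) - (b - c) * (p a * (p b * f d c) - p a * (p d * f b c))
  s-cleared a b c d = begin
    (b - c) * ((b - d) * ((c - d) * s a b c d))
      ≡⟨ cong (λ z → (b - c) * ((b - d) * z)) (s-eq a b c d) ⟩
    (b - c) * ((b - d) * (r a b c d - r a b d c))
      ≡⟨ lem (b - c) (b - d) (r a b c d) (r a b d c) ⟩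
    (b - d) * ((b - c) * r a b c d) - (b - c) * ((b - d) * r a b d c)
      ≡⟨ cong₂ (λ y z → (b - d) * y - (b - c) * z) (r-eq a b c d) (r-eq a b d c) ⟩
    _ ∎
    where
    lem : ∀ u v y z → u * (v * (y - z)) ≡ v * (u * y) - u * (v * z)
    lem = solve-∀

  -- Exchanging b and c pairs up the values of f: they enter only through `alt`, and coefficients
  -- such as (b - d) - (c - d) produce the common factor b - c.
  s-antisym : ∀ a b c d → b ≢ c → (b - d) * ((c - d) * (s a b c d - s a c b d)) ≡
    p a * p b * alt c d - p a * p c * alt b d + p a * p d * alt b c
  s-antisym a b c d b≢c = cancel-difference b≢c (begin
    (b - c) * ((b - d) * ((c - d) * (s a b c d - s a c b d)))
      ≡⟨ lem₁ b c d (s a b c d) (s a c b d) ⟩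
    (b - c) * ((b - d) * ((c - d) * s a b c d)) + (c - b) * ((c - d) * ((b - d) * s a c b d))
      ≡⟨ cong₂ _+_ (s-cleared a b c d) (s-cleared a c b d) ⟩
    _
      ≡⟨ lem₂ b c d (p a) (p b) (p c) (p d) (f c d) (f d c) (f b d) (f d b) (f b c) (f c b) ⟩
    (b - c) * (p a * p b * alt c d - p a * p c * alt b d + p a * p d * alt b c) ∎)
    where
    lem₁ : ∀ b c d s t → (b - c) * ((b - d) * ((c - d) * (s - t))) ≡
      (b - c) * ((b - d) * ((c - d) * s)) + (c - b) * ((c - d) * ((b - d) * t))
    lem₁ = solve-∀
    lem₂ : ∀ b c d pa pb pc pd cd dc bd db bc cb →
      ((b - d) * (pa * (pb * cd) - pa * (pc * bd)) - (b - c) * (pa * (pb * dc) - pa * (pd * bc))) +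
      ((c - d) * (pa * (pc * bd) - pa * (pb * cd)) - (c - b) * (pa * (pc * db) - pa * (pd * cb)))
      ≡ (b - c) * (pa * pb * (cd - dc) - pa * pc * (bd - db) + pa * pd * (bc - cb))
    lem₂ = solve-∀

  -- A divided difference is symmetric in its two variables. Hence F a b c d and F b a c d share a
  -- value of v, and three values suffice in `F-antisym`.
  v-sym : ∀ a b c d → a ≢ b → v b a c d ≡ v a b c d
  v-sym a b c d a≢b = cancel-difference a≢b (begin
    (a - b) * v b a c d       ≡⟨ lem a b (v b a c d) ⟩
    - ((b - a) * v b a c d)   ≡⟨ cong -_ (v-eq b a c d) ⟩
    - (s b a c d - s a b c d) ≡⟨ lem′ (s b a c d) (s a b c d) ⟩
    s a b c d - s b a c d     ≡⟨ sym (v-eq a b c d) ⟩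
    (a - b) * v a b c d       ∎)
    where
    lem : ∀ a b v → (a - b) * v ≡ - ((b - a) * v)
    lem = solve-∀
    lem′ : ∀ s t → - (s - t) ≡ t - s
    lem′ = solve-∀

  -- The right side is the signed sum of s over all permutations of a, b, c. It is grouped by the
  -- first argument so that `s-antisym` applies to each pair.
  F-antisym : ∀ a b c d → a ≢ b → (a - c) * ((b - c) * (F a b c d - F b a c d)) ≡
    (s a b c d - s a c b d) + (s b c a d - s b a c d) + (s c a b d - s c b a d)
  F-antisym a b c d a≢b = cancel-difference a≢b (begin
    (a - b) * ((a - c) * ((b - c) * (F a b c d - F b a c d)))
      ≡⟨ lem₁ a b c (F a b c d) (F b a c d) ⟩
    (a - b) * ((a - c) * ((b - c) * F a b c d) - (b - c) * ((a - c) * F b a c d))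
      ≡⟨ cong₂ (λ y z → (a - b) * ((a - c) * y - (b - c) * z)) (F-eq a b c d)
           (trans (F-eq b a c d) (cong (_- v b c a d) (v-sym a b c d a≢b))) ⟩
    (a - b) * ((a - c) * (v a b c d - v a c b d) - (b - c) * (v a b c d - v b c a d))
      ≡⟨ lem₂ a b c (v a b c d) (v a c b d) (v b c a d) ⟩
    (a - b) * ((a - b) * v a b c d - (a - c) * v a c b d + (b - c) * v b c a d)
      ≡⟨ cong ((a - b) *_) (cong₂ _+_ (cong₂ _-_ (v-eq a b c d) (v-eq a c b d)) (v-eq b c a d)) ⟩
    (a - b) * ((s a b c d - s b a c d) - (s a c b d - s c a b d) + (s b c a d - s c b a d))
      ≡⟨ cong ((a - b) *_) (lem₃ (s a b c d) (s b a c d) (s a c b d) (s c a b d) (s b c a d) (s c b a d)) ⟩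
    (a - b) * ((s a b c d - s a c b d) + (s b c a d - s b a c d) + (s c a b d - s c b a d)) ∎)
    where
    lem₁ : ∀ a b c y z → (a - b) * ((a - c) * ((b - c) * (y - z))) ≡
      (a - b) * ((a - c) * ((b - c) * y) - (b - c) * ((a - c) * z))
    lem₁ = solve-∀
    lem₂ : ∀ a b c x y z → (a - b) * ((a - c) * (x - y) - (b - c) * (x - z)) ≡
      (a - b) * ((a - b) * x - (a - c) * y + (b - c) * z)
    lem₂ = solve-∀
    lem₃ : ∀ t u v w y z → (t - u) - (v - w) + (y - z) ≡ (t - v) + (y - u) + (w - z)
    lem₃ = solve-∀

  -- One term for each splitting of the four variables into a pair for p and a pair for `alt`. Three
  -- uses of `s-antisym` give nine terms; those with d inside `alt` come in twos and merge by (a -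
  -- d) - (b - d) = a - b.
  six-term : ∀ a b c d → a ≢ b → b ≢ c → a ≢ c →
    (a - d) * ((b - d) * ((c - d) * ((a - c) * ((b - c) * (F a b c d - F b a c d))))) ≡
      (a - b) * (p a * p b * alt c d) - (a - c) * (p a * p c * alt b d) + (a - d) * (p a * p d * alt b c)
    + (b - c) * (p b * p c * alt a d) - (b - d) * (p b * p d * alt a c) + (c - d) * (p c * p d * alt a b)
  six-term a b c d a≢b b≢c a≢c = begin
    (a - d) * ((b - d) * ((c - d) * ((a - c) * ((b - c) * (F a b c d - F b a c d)))))
      ≡⟨ cong (λ z → (a - d) * ((b - d) * ((c - d) * z))) (F-antisym a b c d a≢b) ⟩
    (a - d) * ((b - d) * ((c - d) * (A + B + C)))
      ≡⟨ lem₁ (a - d) (b - d) (c - d) A B C ⟩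
    (a - d) * ((b - d) * ((c - d) * A)) + (b - d) * ((c - d) * ((a - d) * B)) + (c - d) * ((a - d) * ((b - d) * C))
      ≡⟨ cong₂ _+_ (cong₂ _+_ (cong ((a - d) *_) (s-antisym a b c d b≢c))
           (cong ((b - d) *_) (s-antisym b c a d (a≢c ∘ sym))))
           (cong ((c - d) *_) (s-antisym c a b d a≢b)) ⟩
    _
      ≡⟨ lem₂ a b c d (p a) (p b) (p c) (p d) (f c d) (f d c) (f b d) (f d b) (f b c) (f c b)
           (f a d) (f d a) (f a c) (f c a) (f a b) (f b a) ⟩
    _ ∎
    where
    A B C : ℤ
    A = s a b c d - s a c b d
    B = s b c a d - s b a c d
    C = s c a b d - s c b a d
    lem₁ : ∀ x y z A B C → x * (y * (z * (A + B + C))) ≡ x * (y * (z * A)) + y * (z * (x * B)) + z * (x * (y * C))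
    lem₁ = solve-∀
    lem₂ : ∀ a b c d pa pb pc pd cd dc bd db bc cb ad da ac ca ab ba →
      (a - d) * (pa * pb * (cd - dc) - pa * pc * (bd - db) + pa * pd * (bc - cb)) +
      (b - d) * (pb * pc * (ad - da) - pb * pa * (cd - dc) + pb * pd * (ca - ac)) +
      (c - d) * (pc * pa * (bd - db) - pc * pb * (ad - da) + pc * pd * (ab - ba)) ≡
      (a - b) * (pa * pb * (cd - dc)) - (a - c) * (pa * pc * (bd - db)) + (a - d) * (pa * pd * (bc - cb))
      + (b - c) * (pb * pc * (ad - da)) - (b - d) * (pb * pd * (ac - ca)) + (c - d) * (pc * pd * (ab - ba))
    lem₂ = solve-∀

-- Ballot numbers


-- Catalan's triangle along antidiagonals: the usual entry (n , k) is ballot k (n ∸ k + 1).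
ballot : ℕ → ℕ → ℕ
ballot zero    g       = 1
ballot (suc k) zero    = 0
ballot (suc k) (suc g) = ballot (suc k) g ℕ.+ ballot k (suc (suc g))

ballot-factorial-step : ∀ k g b₁ b₂ →
  b₁ ℕ.* ((suc k) ! ℕ.* (suc k ℕ.+ g) !) ℕ.* (suc k ℕ.+ suc k ℕ.+ g) ≡ (suc k ℕ.+ suc k ℕ.+ g) ! ℕ.* g →
  b₂ ℕ.* (k ! ℕ.* (k ℕ.+ (2 ℕ.+ g)) !) ℕ.* (k ℕ.+ k ℕ.+ (2 ℕ.+ g)) ≡ (k ℕ.+ k ℕ.+ (2 ℕ.+ g)) ! ℕ.* (2 ℕ.+ g) →
  (b₁ ℕ.+ b₂) ℕ.* ((suc k) ! ℕ.* (suc k ℕ.+ suc g) !) ℕ.* (suc k ℕ.+ suc k ℕ.+ suc g)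
    ≡ (suc k ℕ.+ suc k ℕ.+ suc g) ! ℕ.* suc g
-- Both hypotheses have the denominator N = 2k + 2 + g. What remains is (2 + k + g) g + (1 + k)(2 +
-- g) = N (1 + g).
ballot-factorial-step k g b₁ b₂ h₁ h₂ = ℕ.*-cancelˡ-≡ _ _ N (begin
  N ℕ.* ((b₁ ℕ.+ b₂) ℕ.* ((suc k) ! ℕ.* (suc k ℕ.+ suc g) !) ℕ.* (suc k ℕ.+ suc k ℕ.+ suc g))
    ≡⟨ cong₂ (λ x y → N ℕ.* ((b₁ ℕ.+ b₂) ℕ.* ((suc k) ! ℕ.* x !) ℕ.* y)) (cong suc (ℕ.+-suc k g)) 1+N ⟩
  N ℕ.* ((b₁ ℕ.+ b₂) ℕ.* (suc k ℕ.* k ! ℕ.* ((2 ℕ.+ k ℕ.+ g) ℕ.* P)) ℕ.* suc N)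
    ≡⟨ lem₁ k g b₁ b₂ (k !) P N ⟩
  suc N ℕ.* ((2 ℕ.+ k ℕ.+ g) ℕ.* (b₁ ℕ.* (suc k ℕ.* k ! ℕ.* P) ℕ.* N) ℕ.+ suc k ℕ.* (b₂ ℕ.* (k ! ℕ.* ((2 ℕ.+ k ℕ.+ g) ℕ.* P)) ℕ.* N))
    ≡⟨ cong₂ (λ x y → suc N ℕ.* ((2 ℕ.+ k ℕ.+ g) ℕ.* x ℕ.+ suc k ℕ.* y)) ih₁ ih₂ ⟩
  suc N ℕ.* ((2 ℕ.+ k ℕ.+ g) ℕ.* (N ! ℕ.* g) ℕ.+ suc k ℕ.* (N ! ℕ.* (2 ℕ.+ g)))
    ≡⟨ lem₂ k g (N !) ⟩
  N ℕ.* (suc N ℕ.* N ! ℕ.* suc g)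
    ≡⟨ cong (λ x → N ℕ.* (x ! ℕ.* suc g)) (sym 1+N) ⟩
  N ℕ.* ((suc k ℕ.+ suc k ℕ.+ suc g) ! ℕ.* suc g) ∎)
  where
  N P : ℕ
  N = 2 ℕ.+ (k ℕ.+ k ℕ.+ g)
  P = (suc k ℕ.+ g) !
  1+N : suc k ℕ.+ suc k ℕ.+ suc g ≡ suc N
  1+N = lem k g
    where
    lem : ∀ k g → 1 ℕ.+ k ℕ.+ (1 ℕ.+ k) ℕ.+ (1 ℕ.+ g) ≡ 3 ℕ.+ (k ℕ.+ k ℕ.+ g)
    lem = ℕ-Solver.solve-∀
  ih₁ : b₁ ℕ.* (suc k ℕ.* k ! ℕ.* P) ℕ.* N ≡ N ! ℕ.* g
  ih₁ = subst (λ n → b₁ ℕ.* (suc k ℕ.* k ! ℕ.* P) ℕ.* n ≡ n ! ℕ.* g) (cong (λ z → suc z ℕ.+ g) (ℕ.+-suc k k)) h₁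
  ih₂ : b₂ ℕ.* (k ! ℕ.* ((2 ℕ.+ k ℕ.+ g) ℕ.* P)) ℕ.* N ≡ N ! ℕ.* (2 ℕ.+ g)
  ih₂ = subst₂ (λ m n → b₂ ℕ.* (k ! ℕ.* m !) ℕ.* n ≡ n ! ℕ.* (2 ℕ.+ g)) (shift k) (shift (k ℕ.+ k)) h₂
    where
    shift : ∀ z → z ℕ.+ (2 ℕ.+ g) ≡ 2 ℕ.+ z ℕ.+ g
    shift z = trans (ℕ.+-suc z (suc g)) (cong suc (ℕ.+-suc z g))
  lem₁ : ∀ k g b₁ b₂ K P N → N ℕ.* ((b₁ ℕ.+ b₂) ℕ.* ((1 ℕ.+ k) ℕ.* K ℕ.* ((2 ℕ.+ k ℕ.+ g) ℕ.* P)) ℕ.* (1 ℕ.+ N)) ≡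
    (1 ℕ.+ N) ℕ.* ((2 ℕ.+ k ℕ.+ g) ℕ.* (b₁ ℕ.* ((1 ℕ.+ k) ℕ.* K ℕ.* P) ℕ.* N) ℕ.+ (1 ℕ.+ k) ℕ.* (b₂ ℕ.* (K ℕ.* ((2 ℕ.+ k ℕ.+ g) ℕ.* P)) ℕ.* N))
  lem₁ = ℕ-Solver.solve-∀
  lem₂ : ∀ k g M → (3 ℕ.+ (k ℕ.+ k ℕ.+ g)) ℕ.* ((2 ℕ.+ k ℕ.+ g) ℕ.* (M ℕ.* g) ℕ.+ (1 ℕ.+ k) ℕ.* (M ℕ.* (2 ℕ.+ g))) ≡
    (2 ℕ.+ (k ℕ.+ k ℕ.+ g)) ℕ.* ((3 ℕ.+ (k ℕ.+ k ℕ.+ g)) ℕ.* M ℕ.* (1 ℕ.+ g))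
  lem₂ = ℕ-Solver.solve-∀

-- The closed form g/(2k+g) times the binomial coefficient of 2k+g over k, with denominators
-- cleared.
ballot-factorial : ∀ k g → ballot k g ℕ.* (k ! ℕ.* (k ℕ.+ g) !) ℕ.* (k ℕ.+ k ℕ.+ g) ≡ (k ℕ.+ k ℕ.+ g) ! ℕ.* g
ballot-factorial zero    g       = lem (g !) g
  where
  lem : ∀ f g → 1 ℕ.* (1 ℕ.* f) ℕ.* g ≡ f ℕ.* g
  lem = ℕ-Solver.solve-∀
ballot-factorial (suc k) zero    = sym (ℕ.*-zeroʳ ((suc k ℕ.+ suc k ℕ.+ 0) !))
ballot-factorial (suc k) (suc g) =
  ballot-factorial-step k g (ballot (suc k) g) (ballot k (2 ℕ.+ g)) (ballot-factorial (suc k) g) (ballot-factorial k (2 ℕ.+ g))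

ballot≡catalan : ∀ k → ballot k 1 ≡ catalan k
ballot≡catalan k = sym (trans (/-congˡ {o = k ! ℕ.* (suc k) !} {{nz}} (2k!≡)) (m*n/n≡m (ballot k 1) (k ! ℕ.* (suc k) !) {{nz}}))
  where
  nz : ℕ.NonZero (k ! ℕ.* (suc k) !)
  nz = ℕ._!*_!≢0 k (suc k)
  2k!≡ : (2 ℕ.* k) ! ≡ ballot k 1 ℕ.* (k ! ℕ.* (suc k) !)
  2k!≡ = ℕ.*-cancelʳ-≡ _ _ (suc (2 ℕ.* k)) (sym (begin
    ballot k 1 ℕ.* (k ! ℕ.* (suc k) !) ℕ.* suc (2 ℕ.* k)
      ≡⟨ subst₂ (λ m n → ballot k 1 ℕ.* (k ! ℕ.* m !) ℕ.* n ≡ n ! ℕ.* 1) (ℕ.+-comm k 1) (lem k) (ballot-factorial k 1) ⟩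
    suc (2 ℕ.* k) ! ℕ.* 1
      ≡⟨ trans (ℕ.*-identityʳ _) (ℕ.*-comm (suc (2 ℕ.* k)) ((2 ℕ.* k) !)) ⟩
    (2 ℕ.* k) ! ℕ.* suc (2 ℕ.* k) ∎))
    where
    lem : ∀ k → k ℕ.+ k ℕ.+ 1 ≡ 1 ℕ.+ 2 ℕ.* k
    lem = ℕ-Solver.solve-∀

-- The sum of ballot (k+i) (g-i) x^i over i ≤ g, a stretch of an antidiagonal.
ballotPoly : ℕ → ℕ → ℤ → ℤ
ballotPoly k zero    x = + ballot k zero
ballotPoly k (suc g) x = + ballot k (suc g) + x * ballotPoly (suc k) g x

-- The term `ballot k (2 + g)` makes the induction on g close: when the constant coefficients are
-- peeled off, the ballot recurrence turns it into the corresponding term for k + 1.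
ballotPoly-suc : ∀ k g x →
  (x - 1ℤ) * ballotPoly (suc k) (suc g) x + ballotPoly (suc k) g x + + ballot k (2 ℕ.+ g)
    ≡ powℤ x (suc g) * + ballot (suc k ℕ.+ g) 1
ballotPoly-suc k zero    x rewrite ℕ.+-identityʳ k = lem x (+ ballot k 2)
  where
  lem : ∀ x b → (x - 1ℤ) * (b + x * 0ℤ) + 0ℤ + b ≡ (x * 1ℤ) * b
  lem = solve-∀
ballotPoly-suc k (suc g) x = begin
  (x - 1ℤ) * (+ (b₂ ℕ.+ b₃) + x * r₁) + (+ b₂ + x * r₀) + + b₃
    ≡⟨ lem x (+ b₂) (+ b₃) r₁ r₀ ⟩
  x * ((x - 1ℤ) * r₁ + r₀ + + (b₂ ℕ.+ b₃))
    ≡⟨ cong (x *_) (ballotPoly-suc (suc k) g x) ⟩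
  x * (powℤ x (suc g) * + ballot (suc (suc k) ℕ.+ g) 1)
    ≡⟨ sym (ℤ.*-assoc x (powℤ x (suc g)) _) ⟩
  powℤ x (2 ℕ.+ g) * + ballot (suc (suc k) ℕ.+ g) 1
    ≡⟨ cong (λ n → powℤ x (2 ℕ.+ g) * + ballot (suc n) 1) (sym (ℕ.+-suc k g)) ⟩
  powℤ x (2 ℕ.+ g) * + ballot (suc k ℕ.+ suc g) 1 ∎
  where
  b₂ b₃ : ℕ
  b₂ = ballot (suc k) (suc g)
  b₃ = ballot k (3 ℕ.+ g)
  r₁ r₀ : ℤ
  r₁ = ballotPoly (2 ℕ.+ k) (suc g) x
  r₀ = ballotPoly (2 ℕ.+ k) g x
  lem : ∀ x b₂ b₃ r₁ r₀ → (x - 1ℤ) * ((b₂ + b₃) + x * r₁) + (b₂ + x * r₀) + b₃ ≡ x * ((x - 1ℤ) * r₁ + r₀ + (b₂ + b₃))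
  lem = solve-∀

-- For k = 0 nothing precedes the antidiagonal. Peeling off the constant coefficient 1 leads to
-- `ballotPoly-suc` at k = 0, with that 1 as the extra term.
ballotPoly₀-suc : ∀ g x → (x - 1ℤ) * ballotPoly 0 (suc g) x + ballotPoly 0 g x ≡ powℤ x (suc g) * + ballot g 1
ballotPoly₀-suc zero    x = lem x
  where
  lem : ∀ x → (x - 1ℤ) * (1ℤ + x * 0ℤ) + 1ℤ ≡ (x * 1ℤ) * 1ℤ
  lem = solve-∀
ballotPoly₀-suc (suc g) x = begin
  (x - 1ℤ) * (1ℤ + x * r₁) + (1ℤ + x * r₀)
    ≡⟨ lem x r₁ r₀ ⟩
  x * ((x - 1ℤ) * r₁ + r₀ + 1ℤ)
    ≡⟨ cong (x *_) (ballotPoly-suc 0 g x) ⟩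
  x * (powℤ x (suc g) * + ballot (suc g) 1)
    ≡⟨ sym (ℤ.*-assoc x (powℤ x (suc g)) _) ⟩
  powℤ x (2 ℕ.+ g) * + ballot (suc g) 1 ∎
  where
  r₁ r₀ : ℤ
  r₁ = ballotPoly 1 (suc g) x
  r₀ = ballotPoly 1 g x
  lem : ∀ x r₁ r₀ → (x - 1ℤ) * (1ℤ + x * r₁) + (1ℤ + x * r₀) ≡ x * ((x - 1ℤ) * r₁ + r₀ + 1ℤ)
  lem = solve-∀

powℤ-1 : ∀ n → powℤ 1ℤ n ≡ 1ℤ
powℤ-1 zero    = refl
powℤ-1 (suc n) = trans (ℤ.*-identityˡ _) (powℤ-1 n)

ballotPoly₀-1 : ∀ g → ballotPoly 0 g 1ℤ ≡ + ballot g 1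
ballotPoly₀-1 g = begin
  ballotPoly 0 g 1ℤ                                             ≡⟨ lem (ballotPoly 0 (suc g) 1ℤ) _ ⟩
  (1ℤ - 1ℤ) * ballotPoly 0 (suc g) 1ℤ + ballotPoly 0 g 1ℤ      ≡⟨ ballotPoly₀-suc g 1ℤ ⟩
  powℤ 1ℤ (suc g) * + ballot g 1                                ≡⟨ cong (_* + ballot g 1) (powℤ-1 (suc g)) ⟩
  1ℤ * + ballot g 1                                             ≡⟨ ℤ.*-identityˡ _ ⟩
  + ballot g 1 ∎
  where
  lem : ∀ r s → s ≡ (1ℤ - 1ℤ) * r + s
  lem = solve-∀

-- The two factors of the wedge

parity : ℕ → ℕ
parity zero          = 0
parity (suc zero)    = 1
parity (suc (suc j)) = parity j

-- V j and V (j + 1) are the factors w and u for m = j + 2.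
V : ℕ → ℤ → ℤ
V j x = powℤ x (parity j) * ballotPoly 0 ⌊ j /2⌋ (x * x)

powℤ-parity : ∀ x j → powℤ x j ≡ powℤ x (parity j) * powℤ (x * x) ⌊ j /2⌋
powℤ-parity x zero          = refl
powℤ-parity x (suc zero)    = sym (ℤ.*-identityʳ _)
powℤ-parity x (suc (suc j)) = trans (cong (λ z → x * (x * z)) (powℤ-parity x j)) (lem x (powℤ x (parity j)) _)
  where
  lem : ∀ x u v → x * (x * (u * v)) ≡ u * ((x * x) * v)
  lem = solve-∀

V-1 : ∀ j → V j 1ℤ ≡ + ballot ⌊ j /2⌋ 1
V-1 j = trans (cong₂ _*_ (powℤ-1 (parity j)) (ballotPoly₀-1 ⌊ j /2⌋)) (ℤ.*-identityˡ _)

V-neg-1 : ∀ j → V j -1ℤ ≡ powℤ -1ℤ j * V j 1ℤ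
V-neg-1 j = cong₂ _*_
  (sym (trans (powℤ-parity -1ℤ j) (trans (cong (powℤ -1ℤ (parity j) *_) (powℤ-1 ⌊ j /2⌋)) (ℤ.*-identityʳ (powℤ -1ℤ (parity j))))))
  (trans (sym (ℤ.*-identityˡ (ballotPoly 0 ⌊ j /2⌋ 1ℤ))) (cong (_* ballotPoly 0 ⌊ j /2⌋ 1ℤ) (sym (powℤ-1 (parity j)))))

-- This is `ballotPoly₀-suc` in the variable x², multiplied by x^(parity j); the powers combine to
-- x^(j+2).
V-rec : ∀ j x → (x * x - 1ℤ) * V (2 ℕ.+ j) x ≡ powℤ x (2 ℕ.+ j) * V j 1ℤ - V j x
V-rec j x = begin
  (x * x - 1ℤ) * (u * r₁)
    ≡⟨ lem (x * x - 1ℤ) u r₁ r₀ ⟩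
  u * ((x * x - 1ℤ) * r₁ + r₀) - u * r₀
    ≡⟨ cong (λ z → u * z - u * r₀) (ballotPoly₀-suc ⌊ j /2⌋ (x * x)) ⟩
  u * (powℤ (x * x) (suc ⌊ j /2⌋) * + ballot ⌊ j /2⌋ 1) - u * r₀
    ≡⟨ cong (_- u * r₀) (sym (ℤ.*-assoc u (powℤ (x * x) (suc ⌊ j /2⌋)) _)) ⟩
  u * powℤ (x * x) (suc ⌊ j /2⌋) * + ballot ⌊ j /2⌋ 1 - u * r₀
    ≡⟨ cong₂ (λ y z → y * z - u * r₀) (sym (powℤ-parity x (2 ℕ.+ j))) (sym (V-1 j)) ⟩
  powℤ x (2 ℕ.+ j) * V j 1ℤ - V j x ∎
  where
  u r₁ r₀ : ℤ
  u = powℤ x (parity j)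
  r₁ = ballotPoly 0 (suc ⌊ j /2⌋) (x * x)
  r₀ = ballotPoly 0 ⌊ j /2⌋ (x * x)
  lem : ∀ d u r₁ r₀ → d * (u * r₁) ≡ u * (d * r₁ + r₀) - u * r₀
  lem = solve-∀

-- Functions with a - b ∣ f a - f b stand in for polynomial functions: if such an f
-- vanishes at all large n, then n - a divides f a for all of them, so f = 0.
-- This extends identities obtained by cancelling differences to points with repeated coordinates.
record CongruencePreserving (f : ℤ → ℤ) : Set where
  field
    slope : ∀ a b → ∃[ q ] f a - f b ≡ (a - b) * q
open CongruencePreserving

id-cp : CongruencePreserving id
id-cp .slope a b = 1ℤ , sym (ℤ.*-identityʳ _)

const-cp : ∀ c → CongruencePreserving (λ _ → c)
const-cp c .slope a b = 0ℤ , trans (ℤ.+-inverseʳ c) (sym (ℤ.*-zeroʳ (a - b)))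

+-cp : ∀ {f g} → CongruencePreserving f → CongruencePreserving g → CongruencePreserving (λ t → f t + g t)
+-cp {f} {g} F G .slope a b with F .slope a b | G .slope a b
... | p , Fp | q , Gq = p + q , (begin
  (f a + g a) - (f b + g b)   ≡⟨ lem₁ (f a) (g a) (f b) (g b) ⟩
  (f a - f b) + (g a - g b)   ≡⟨ cong₂ _+_ Fp Gq ⟩
  (a - b) * p + (a - b) * q   ≡⟨ sym (ℤ.*-distribˡ-+ (a - b) p q) ⟩
  (a - b) * (p + q)           ∎)
  where
  lem₁ : ∀ s t u v → (s + t) - (u + v) ≡ (s - u) + (t - v)
  lem₁ = solve-∀

*-cp : ∀ {f g} → CongruencePreserving f → CongruencePreserving g → CongruencePreserving (λ t → f t * g t)
*-cp {f} {g} F G .slope a b with F .slope a b | G .slope a b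
... | p , Fp | q , Gq = p * g a + f b * q , (begin
  f a * g a - f b * g b                         ≡⟨ lem₁ (f a) (g a) (f b) (g b) ⟩
  (f a - f b) * g a + f b * (g a - g b)         ≡⟨ cong₂ (λ y z → y * g a + f b * z) Fp Gq ⟩
  (a - b) * p * g a + f b * ((a - b) * q)       ≡⟨ lem₂ (a - b) p (g a) (f b) q ⟩
  (a - b) * (p * g a + f b * q)                 ∎)
  where
  lem₁ : ∀ s t u v → s * t - u * v ≡ (s - u) * t + u * (t - v)
  lem₁ = solve-∀
  lem₂ : ∀ d p s t q → d * p * s + t * (d * q) ≡ d * (p * s + t * q)
  lem₂ = solve-∀

neg-cp : ∀ {f} → CongruencePreserving f → CongruencePreserving (λ t → - f t)
neg-cp {f} F .slope a b with F .slope a b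
... | p , Fp = - p , trans (lem (f a) (f b)) (trans (cong -_ Fp) (lem′ (a - b) p))
  where
  lem : ∀ u v → - u - - v ≡ - (u - v)
  lem = solve-∀
  lem′ : ∀ d p → - (d * p) ≡ d * - p
  lem′ = solve-∀

powℤ-cp : ∀ {f} → CongruencePreserving f → ∀ n → CongruencePreserving (λ t → powℤ (f t) n)
powℤ-cp F zero    = const-cp 1ℤ
powℤ-cp F (suc n) = *-cp F (powℤ-cp F n)

mon-cp : ∀ {x : ℤ → Point} → (∀ i → CongruencePreserving (λ t → x t i)) → ∀ e → CongruencePreserving (λ t → mon (x t) e)
mon-cp X []      = const-cp 1ℤ
mon-cp X (a ∷ e) = *-cp (powℤ-cp (X 0) a) (mon-cp (X ∘ suc) e)

ev-cp : ∀ {x : ℤ → Point} → (∀ i → CongruencePreserving (λ t → x t i)) → ∀ p → CongruencePreserving (λ t → ev (x t) p)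
ev-cp X []            = const-cp 0ℤ
ev-cp X ((c , e) ∷ p) = +-cp (*-cp (const-cp c) (mon-cp X e)) (ev-cp X p)

ballotPoly-cp : ∀ {f} → CongruencePreserving f → ∀ k g → CongruencePreserving (λ t → ballotPoly k g (f t))
ballotPoly-cp F k zero    = const-cp _
ballotPoly-cp F k (suc g) = +-cp (const-cp (+ ballot k (suc g))) (*-cp F (ballotPoly-cp F (suc k) g))

V-cp : ∀ j → CongruencePreserving (V j)
V-cp j = *-cp (powℤ-cp id-cp (parity j)) (ballotPoly-cp (*-cp id-cp id-cp) 0 ⌊ j /2⌋)

cp-unique : ∀ {f g} → CongruencePreserving f → CongruencePreserving g →
  ∀ N → (∀ n → f (+ (N ℕ.+ n)) ≡ g (+ (N ℕ.+ n))) → ∀ a → f a ≡ g a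
cp-unique {f} {g} F G N f≡g a = ℤ.i-j≡0⇒i≡j (f a) (g a) (zero-case ∣ q ∣ refl)
  where
  h : ℤ
  h = f a - g a
  n : ℕ
  -- Large enough that |t - a| > |h|; as t - a divides h, this forces h = 0.
  n = ∣ a ∣ ℕ.+ suc ∣ h ∣
  t q : ℤ
  t = + (N ℕ.+ n)
  q = proj₁ (G .slope t a) - proj₁ (F .slope t a)
  h≡ : h ≡ (t - a) * q
  h≡ = begin
    f a - g a                             ≡⟨ lem (f t) (f a) (g a) ⟩
    (f t - g a) - (f t - f a)             ≡⟨ cong (λ z → (z - g a) - (f t - f a)) (f≡g n) ⟩
    (g t - g a) - (f t - f a)             ≡⟨ cong₂ _-_ (proj₂ (G .slope t a)) (proj₂ (F .slope t a)) ⟩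
    (t - a) * proj₁ (G .slope t a) - (t - a) * proj₁ (F .slope t a) ≡⟨ lem′ (t - a) _ _ ⟩
    (t - a) * q ∎
    where
    lem : ∀ u v w → v - w ≡ (u - w) - (u - v)
    lem = solve-∀
    lem′ : ∀ d u v → d * u - d * v ≡ d * (u - v)
    lem′ = solve-∀
  ∣h∣≡ : ∣ h ∣ ≡ ∣ t - a ∣ ℕ.* ∣ q ∣
  ∣h∣≡ = trans (cong ∣_∣ h≡) (ℤ.abs-* (t - a) q)
  ∣h∣< : suc ∣ h ∣ ≤ ∣ t - a ∣
  ∣h∣< = ℕ.+-cancelˡ-≤ ∣ a ∣ _ _ (ℕ.≤-trans (ℕ.m≤n+m n N) (ℕ.≤-trans
    (ℕ.≤-reflexive (cong ∣_∣ (lem t a))) (ℤ.∣i+j∣≤∣i∣+∣j∣ a (t - a))))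
    where
    lem : ∀ t a → t ≡ a + (t - a)
    lem = solve-∀
  zero-case : ∀ k → ∣ q ∣ ≡ k → h ≡ 0ℤ
  zero-case zero    eq = ℤ.∣i∣≡0⇒i≡0 (trans ∣h∣≡ (trans (cong (∣ t - a ∣ ℕ.*_) eq) (ℕ.*-zeroʳ ∣ t - a ∣)))
  zero-case (suc k) eq = contradiction
    (ℕ.≤-trans ∣h∣< (ℕ.≤-trans (ℕ.m≤m*n ∣ t - a ∣ (suc k)) (ℕ.≤-reflexive (trans (cong (∣ t - a ∣ ℕ.*_) (sym eq)) (sym ∣h∣≡)))))
    (ℕ.<-irrefl refl)

-- The evaluation at the alternating point


evAlt : ℕ → ℤ → ℤ → ℤ
evAlt j a b = ev (a ◂ b ◂ altPoint) (schub₂₁ j)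

-- Period two allows 1, -1 to be detached as third and fourth variables while the tail stays the
-- alternating point of the smaller polynomial.
altPoint-periodic : ∀ i → (1ℤ ◂ -1ℤ ◂ altPoint) i ≡ altPoint i
altPoint-periodic zero          = refl
altPoint-periodic (suc zero)    = refl
altPoint-periodic (suc (suc i)) = lem (altPoint i)
  where
  lem : ∀ x → x ≡ -1ℤ * (-1ℤ * x)
  lem = solve-∀

Long-weaken : ∀ {m n p} → m ≤ n → Long n p → Long m p
Long-weaken m≤n = All.map (ℕ.≤-trans m≤n)

schub₂₁-long : ∀ j → Long 2 (schub₂₁ j)
schub₂₁-long zero          = s≤s (s≤s z≤n) ∷ []
schub₂₁-long (suc zero)    = s≤s (s≤s z≤n) ∷ []
schub₂₁-long (suc (suc j)) = dd-long 2 1 _ (dd-long 2 0 _ (dd-long 2 2 _ (dd-long 2 1 _ (dd-long 2 0 _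
  (cons-long 1 _ _ (cons-long 0 _ _ (Long-weaken z≤n (schub₂₁-long j))))))))

-- The sign in front of the wedge; each step contributes (-1)^j, the value of x^(j+2) at -1.
ε : ℕ → ℤ
ε zero          = 1ℤ
ε (suc zero)    = -1ℤ
ε (suc (suc j)) = powℤ -1ℤ j * ε j

module Step (j : ℕ) where

  m : ℕ
  m = 2 ℕ.+ j

  q₀ q₁ q₂ q₃ q₄ : Poly
  q₀ = pre (m ∷ m ∷ []) (schub₂₁ j)
  q₁ = dd 1 q₀
  q₂ = dd 2 q₁
  q₃ = dd 0 q₂
  q₄ = dd 1 q₃

  at₄ : Poly → ℤ → ℤ → ℤ → ℤ → ℤ
  at₄ p a b c d = ev (a ◂ b ◂ c ◂ d ◂ altPoint) p

  ev-q₀ : ∀ a b c d → at₄ q₀ a b c d ≡ powℤ a m * (powℤ b m * evAlt j c d)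
  ev-q₀ a b c d = trans (ev-cons _ m (map (cons m) (schub₂₁ j))) (cong (powℤ a m *_) (ev-cons _ m (schub₂₁ j)))

  long₀ : Long 4 q₀
  long₀ = cons-long 3 m _ (cons-long 2 m _ (schub₂₁-long j))
  long₁ : Long 4 q₁
  long₁ = dd-long 4 1 q₀ long₀
  long₂ : Long 4 q₂
  long₂ = dd-long 4 2 q₁ long₁
  long₃ : Long 4 q₃
  long₃ = dd-long 4 0 q₂ long₂

  open SixTerm (λ x → powℤ x m) (evAlt j) (at₄ q₁) (at₄ q₂) (at₄ q₃) (at₄ q₄)
    (λ a b c d → trans (dd-ev 1 (a ◂ b ◂ c ◂ d ◂ altPoint) q₀ (Long-weaken (s≤s (s≤s (s≤s z≤n))) long₀))
      (cong₂ _-_ (ev-q₀ a b c d) (ev-q₀ a c b d)))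
    (λ a b c d → dd-ev 2 (a ◂ b ◂ c ◂ d ◂ altPoint) q₁ long₁)
    (λ a b c d → dd-ev 0 (a ◂ b ◂ c ◂ d ◂ altPoint) q₂ (Long-weaken (s≤s (s≤s z≤n)) long₂))
    (λ a b c d → dd-ev 1 (a ◂ b ◂ c ◂ d ◂ altPoint) q₃ (Long-weaken (s≤s (s≤s (s≤s z≤n))) long₃))
    public

  evAlt-suc : ∀ a b → evAlt (2 ℕ.+ j) a b ≡ at₄ q₄ a b 1ℤ -1ℤ
  evAlt-suc a b = trans
    (cong (λ p → ev (a ◂ b ◂ altPoint) (dd 1 (dd 0 (dd 2 (dd 1 p))))) (dd-gap₁ m (schub₂₁ j)))
    (ev-cong periodic q₄)
    where
    periodic : ∀ i → (a ◂ b ◂ altPoint) i ≡ (a ◂ b ◂ 1ℤ ◂ -1ℤ ◂ altPoint) i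
    periodic zero          = refl
    periodic (suc zero)    = refl
    periodic (suc (suc i)) = sym (altPoint-periodic i)

-- The antisymmetric part as a wedge

wedge : (ℤ → ℤ) → (ℤ → ℤ) → ℤ → ℤ → ℤ
wedge u w a b = u a * w b - u b * w a

Antisym : ℕ → ℤ → ℤ → Set
Antisym j a b = evAlt j a b - evAlt j b a ≡ ε j * wedge (V (suc j)) (V j) a b

-- This is `six-term` at c = 1, d = -1. Every `alt` is a wedge by hypothesis, and parity expresses
-- the values at -1 by those at 1. The six terms then form a 2 by 2 determinant whose entries are
-- the right sides of `V-rec`.
antisym-suc-generic : ∀ j → (∀ a b → Antisym j a b) →
  ∀ a b → a ≢ b → a ≢ 1ℤ → b ≢ 1ℤ → a ≢ -1ℤ → b ≢ -1ℤ → Antisym (2 ℕ.+ j) a b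
antisym-suc-generic j h a b a≢b a≢1 b≢1 a≢-1 b≢-1 =
  cancel-difference b≢1 (cancel-difference a≢1 (cancel-difference {1ℤ} { -1ℤ} (λ ())
    (cancel-difference b≢-1 (cancel-difference a≢-1 (begin
    (a - -1ℤ) * ((b - -1ℤ) * ((1ℤ - -1ℤ) * ((a - 1ℤ) * ((b - 1ℤ) * (evAlt (2 ℕ.+ j) a b - evAlt (2 ℕ.+ j) b a)))))
      ≡⟨ cong₂ (λ y z → (a - -1ℤ) * ((b - -1ℤ) * ((1ℤ - -1ℤ) * ((a - 1ℤ) * ((b - 1ℤ) * (y - z))))))
           (evAlt-suc a b) (evAlt-suc b a) ⟩
    _
      ≡⟨ six-term a b 1ℤ -1ℤ a≢b b≢1 a≢1 ⟩
    _
      ≡⟨ cong₂ _+_ (cong₂ _-_ (cong₂ _+_ (cong₂ _+_ (cong₂ _-_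
           (term (a - b) (p a) (p b) refl refl (trans (h 1ℤ -1ℤ) (cong (e *_) (cong₂ (λ y z → U 1ℤ * y - z * W 1ℤ) W-1 U-1))))
           (term (a - 1ℤ) (p a) (p 1ℤ) refl p1 (h-1 b)))
           (term (a - -1ℤ) (p a) (p -1ℤ) refl refl (h b 1ℤ)))
           (term (b - 1ℤ) (p b) (p 1ℤ) refl p1 (h-1 a)))
           (term (b - -1ℤ) (p b) (p -1ℤ) refl refl (h a 1ℤ)))
           (term (1ℤ - -1ℤ) (p 1ℤ) (p -1ℤ) p1 refl (h a b)) ⟩
    _
      -- In every product the argument -1 occurs exactly once, in p or in a factor of the wedge, so
      -- (-1)^j comes out linearly.
      ≡⟨ lem a b (powℤ a (2 ℕ.+ j)) (powℤ b (2 ℕ.+ j)) (U a) (U b) (W a) (W b) (U 1ℤ) (W 1ℤ) (powℤ -1ℤ j) e ⟩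
    (1ℤ - -1ℤ) * (powℤ -1ℤ j * e * ((powℤ a (3 ℕ.+ j) * U 1ℤ - U a) * (powℤ b (2 ℕ.+ j) * W 1ℤ - W b)
      - (powℤ b (3 ℕ.+ j) * U 1ℤ - U b) * (powℤ a (2 ℕ.+ j) * W 1ℤ - W a)))
      ≡⟨ cong₂ (λ y z → (1ℤ - -1ℤ) * (powℤ -1ℤ j * e * (y - z)))
           (cong₂ _*_ (sym (V-rec (suc j) a)) (sym (V-rec j b)))
           (cong₂ _*_ (sym (V-rec (suc j) b)) (sym (V-rec j a))) ⟩
    _
      ≡⟨ lem′ a b (V (3 ℕ.+ j) a) (V (3 ℕ.+ j) b) (V (2 ℕ.+ j) a) (V (2 ℕ.+ j) b) (powℤ -1ℤ j * e) ⟩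
    (a - -1ℤ) * ((b - -1ℤ) * ((1ℤ - -1ℤ) * ((a - 1ℤ) * ((b - 1ℤ) * (ε (2 ℕ.+ j) * wedge (V (3 ℕ.+ j)) (V (2 ℕ.+ j)) a b)))))
    ∎)))))
  where
  open Step j
  U W : ℤ → ℤ
  U = V (suc j)
  W = V j
  p : ℤ → ℤ
  p x = powℤ x (2 ℕ.+ j)
  e : ℤ
  e = ε j
  W-1 : W -1ℤ ≡ powℤ -1ℤ j * W 1ℤ
  W-1 = V-neg-1 j
  U-1 : U -1ℤ ≡ powℤ -1ℤ (suc j) * U 1ℤ
  U-1 = V-neg-1 (suc j)
  p1 : powℤ 1ℤ (2 ℕ.+ j) ≡ 1ℤ
  p1 = powℤ-1 (2 ℕ.+ j)
  h-1 : ∀ x → evAlt j x -1ℤ - evAlt j -1ℤ x ≡ e * (U x * (powℤ -1ℤ j * W 1ℤ) - powℤ -1ℤ (suc j) * U 1ℤ * W x)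
  h-1 x = trans (h x -1ℤ) (cong (e *_) (cong₂ (λ y z → U x * y - z * W x) W-1 U-1))
  term : ∀ d p q {p′ q′ A A′} → p ≡ p′ → q ≡ q′ → A ≡ A′ → d * (p * q * A) ≡ d * (p′ * q′ * A′)
  term d p q refl refl refl = refl
  lem : ∀ a b pa pb Ua Ub Wa Wb U1 W1 σ e →
      (a - b) * (pa * pb * (e * (U1 * (σ * W1) - -1ℤ * σ * U1 * W1)))
    - (a - 1ℤ) * (pa * 1ℤ * (e * (Ub * (σ * W1) - -1ℤ * σ * U1 * Wb)))
    + (a - -1ℤ) * (pa * (-1ℤ * (-1ℤ * σ)) * (e * (Ub * W1 - U1 * Wb)))
    + (b - 1ℤ) * (pb * 1ℤ * (e * (Ua * (σ * W1) - -1ℤ * σ * U1 * Wa)))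
    - (b - -1ℤ) * (pb * (-1ℤ * (-1ℤ * σ)) * (e * (Ua * W1 - U1 * Wa)))
    + (1ℤ - -1ℤ) * (1ℤ * (-1ℤ * (-1ℤ * σ)) * (e * (Ua * Wb - Ub * Wa)))
    ≡ (1ℤ - -1ℤ) * (σ * e * ((a * pa * U1 - Ua) * (pb * W1 - Wb) - (b * pb * U1 - Ub) * (pa * W1 - Wa)))
  lem = solve-∀
  lem′ : ∀ a b Ua Ub Wa Wb e →
    (1ℤ - -1ℤ) * (e * (((a * a - 1ℤ) * Ua) * ((b * b - 1ℤ) * Wb) - ((b * b - 1ℤ) * Ub) * ((a * a - 1ℤ) * Wa)))
    ≡ (a - -1ℤ) * ((b - -1ℤ) * ((1ℤ - -1ℤ) * ((a - 1ℤ) * ((b - 1ℤ) * (e * (Ua * Wb - Ub * Wa))))))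
  lem′ = solve-∀

evAlt-cpˡ : ∀ j b → CongruencePreserving (λ t → evAlt j t b)
evAlt-cpˡ j b = ev-cp (λ { zero → id-cp ; (suc i) → const-cp ((b ◂ altPoint) i) }) (schub₂₁ j)

evAlt-cpʳ : ∀ j a → CongruencePreserving (λ t → evAlt j a t)
evAlt-cpʳ j a = ev-cp (λ { zero → const-cp a ; (suc zero) → id-cp ; (suc (suc i)) → const-cp (altPoint i) }) (schub₂₁ j)

-‿cp : ∀ {f g} → CongruencePreserving f → CongruencePreserving g → CongruencePreserving (λ t → f t - g t)
-‿cp F G = +-cp F (neg-cp G)

-- The next step evaluates the identity at 1 and -1, points excluded from the generic case. So a is
-- freed first for each b ≥ 2, then b.
antisym-suc : ∀ j → (∀ a b → Antisym j a b) → ∀ a b → Antisym (2 ℕ.+ j) a b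
antisym-suc j h a = cp-unique
  (-‿cp (evAlt-cpʳ k a) (evAlt-cpˡ k a))
  (*-cp (const-cp (ε k)) (-‿cp (*-cp (const-cp (V (suc k) a)) (V-cp k)) (*-cp (V-cp (suc k)) (const-cp (V k a)))))
  2 (λ n → large-b n a)
  where
  k : ℕ
  k = 2 ℕ.+ j
  large-b : ∀ n a → Antisym k a (+ (2 ℕ.+ n))
  large-b n = cp-unique
    (-‿cp (evAlt-cpˡ k b) (evAlt-cpʳ k b))
    (*-cp (const-cp (ε k)) (-‿cp (*-cp (V-cp (suc k)) (const-cp (V k b))) (*-cp (const-cp (V (suc k) b)) (V-cp k))))
    -- Starting at b + 1 keeps a distinct from b as well as from 1 and -1.
    (3 ℕ.+ n)
    (λ i → antisym-suc-generic j h (+ (3 ℕ.+ n ℕ.+ i)) b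
      (λ eq → ℕ.m+1+n≢m (2 ℕ.+ n) {i} (trans (ℕ.+-suc (2 ℕ.+ n) i) (ℤ.+-injective eq)))
      (λ ()) (λ ()) (λ ()) (λ ()))
    where
    b : ℤ
    b = + (2 ℕ.+ n)

-- In both base cases the polynomial is x₁, while `V 0` and `V 2` are 1 and `V 1` is x; the reversed
-- order at j = 1 explains the sign `ε 1`.
antisym : ∀ j a b → Antisym j a b
antisym zero          = lem
  where
  lem : ∀ a b → (1ℤ * ((a * 1ℤ) * (1ℤ * 1ℤ)) + 0ℤ) - (1ℤ * ((b * 1ℤ) * (1ℤ * 1ℤ)) + 0ℤ)
    ≡ 1ℤ * (((a * 1ℤ) * 1ℤ) * (1ℤ * 1ℤ) - ((b * 1ℤ) * 1ℤ) * (1ℤ * 1ℤ))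
  lem = solve-∀
antisym (suc zero)    = lem
  where
  lem : ∀ a b → (1ℤ * ((a * 1ℤ) * (1ℤ * (1ℤ * 1ℤ))) + 0ℤ) - (1ℤ * ((b * 1ℤ) * (1ℤ * (1ℤ * 1ℤ))) + 0ℤ)
    ≡ -1ℤ * ((1ℤ * (1ℤ + (a * a) * 0ℤ)) * ((b * 1ℤ) * 1ℤ) - (1ℤ * (1ℤ + (b * b) * 0ℤ)) * ((a * 1ℤ) * 1ℤ))
  lem = solve-∀
antisym (suc (suc j)) = antisym-suc j (antisym j)

-- Specialisation at (1, -1) and the Catalan numbers

∣powℤ-1∣ : ∀ j → ∣ powℤ -1ℤ j ∣ ≡ 1
∣powℤ-1∣ zero    = refl
∣powℤ-1∣ (suc j) = trans (ℤ.abs-* -1ℤ (powℤ -1ℤ j)) (trans (ℕ.*-identityˡ _) (∣powℤ-1∣ j))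

∣ε∣ : ∀ j → ∣ ε j ∣ ≡ 1
∣ε∣ zero          = refl
∣ε∣ (suc zero)    = refl
∣ε∣ (suc (suc j)) = trans (ℤ.abs-* (powℤ -1ℤ j) (ε j)) (cong₂ ℕ._*_ (∣powℤ-1∣ j) (∣ε∣ j))

-- At (1, -1) the last ∂₁ divides by 2. By opposite parity the two products of the wedge add up
-- instead of cancelling, which supplies this 2.
evalPoly-wPerm : ∀ j → evalPoly altPoint (schubert (wPerm (2 ℕ.+ j)))
  ≡ (ε j * powℤ -1ℤ j) * (V (suc j) 1ℤ * V j 1ℤ)
evalPoly-wPerm j = begin
  evalPoly altPoint (schubert (wPerm (2 ℕ.+ j)))
    ≡⟨ trans (evalPoly≡ev altPoint (schubert (wPerm (2 ℕ.+ j)))) (cong (ev altPoint) (schubert-wPerm j)) ⟩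
  ev altPoint (dd 0 (schub₂₁ j))
    ≡⟨ sym (ev-cong altPoint-periodic (dd 0 (schub₂₁ j))) ⟩
  ev (1ℤ ◂ -1ℤ ◂ altPoint) (dd 0 (schub₂₁ j))
    ≡⟨ cancel-difference {1ℤ} { -1ℤ} (λ ()) (begin
      (1ℤ - -1ℤ) * ev (1ℤ ◂ -1ℤ ◂ altPoint) (dd 0 (schub₂₁ j))
        ≡⟨ dd-ev 0 (1ℤ ◂ -1ℤ ◂ altPoint) (schub₂₁ j) (schub₂₁-long j) ⟩
      evAlt j 1ℤ -1ℤ - evAlt j -1ℤ 1ℤ
        ≡⟨ antisym j 1ℤ -1ℤ ⟩
      ε j * (V (suc j) 1ℤ * V j -1ℤ - V (suc j) -1ℤ * V j 1ℤ)
        ≡⟨ cong (ε j *_) (cong₂ (λ y z → V (suc j) 1ℤ * y - z * V j 1ℤ) (V-neg-1 j) (V-neg-1 (suc j))) ⟩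
      ε j * (V (suc j) 1ℤ * (powℤ -1ℤ j * V j 1ℤ) - powℤ -1ℤ (suc j) * V (suc j) 1ℤ * V j 1ℤ)
        ≡⟨ lem (ε j) (powℤ -1ℤ j) (V (suc j) 1ℤ) (V j 1ℤ) ⟩
      (1ℤ - -1ℤ) * ((ε j * powℤ -1ℤ j) * (V (suc j) 1ℤ * V j 1ℤ)) ∎) ⟩
  (ε j * powℤ -1ℤ j) * (V (suc j) 1ℤ * V j 1ℤ) ∎
  where
  lem : ∀ e σ u w → e * (u * (σ * w) - -1ℤ * σ * u * w) ≡ (1ℤ - -1ℤ) * ((e * σ) * (u * w))
  lem = solve-∀

Φ-wPerm : ∀ j → Φ (wPerm (2 ℕ.+ j)) ≡ catalan ⌊ suc j /2⌋ ℕ.* catalan ⌊ j /2⌋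
Φ-wPerm j = begin
  Φ (wPerm (2 ℕ.+ j))
    ≡⟨ cong ∣_∣ (evalPoly-wPerm j) ⟩
  ∣ (ε j * powℤ -1ℤ j) * (V (suc j) 1ℤ * V j 1ℤ) ∣
    ≡⟨ trans (ℤ.abs-* (ε j * powℤ -1ℤ j) _)
         (cong₂ ℕ._*_ (trans (ℤ.abs-* (ε j) _) (cong₂ ℕ._*_ (∣ε∣ j) (∣powℤ-1∣ j))) (ℤ.abs-* (V (suc j) 1ℤ) (V j 1ℤ))) ⟩
  1 ℕ.* (∣ V (suc j) 1ℤ ∣ ℕ.* ∣ V j 1ℤ ∣)
    ≡⟨ ℕ.*-identityˡ _ ⟩
  ∣ V (suc j) 1ℤ ∣ ℕ.* ∣ V j 1ℤ ∣
    ≡⟨ cong₂ ℕ._*_ (∣V∣ (suc j)) (∣V∣ j) ⟩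
  catalan ⌊ suc j /2⌋ ℕ.* catalan ⌊ j /2⌋ ∎
  where
  ∣V∣ : ∀ j → ∣ V j 1ℤ ∣ ≡ catalan ⌊ j /2⌋
  ∣V∣ j = trans (cong ∣_∣ (V-1 j)) (ballot≡catalan ⌊ j /2⌋)

⌊2*n/2⌋≡n : ∀ n → ⌊ 2 ℕ.* n /2⌋ ≡ n
⌊2*n/2⌋≡n n = trans (cong (λ z → ⌊ n ℕ.+ z /2⌋) (ℕ.+-identityʳ n)) (sym (ℕ.n≡⌊n+n/2⌋ n))

⌊1+2*n/2⌋≡n : ∀ n → ⌊ suc (2 ℕ.* n) /2⌋ ≡ n
⌊1+2*n/2⌋≡n n = trans (cong (λ z → ⌊ suc (n ℕ.+ z) /2⌋) (ℕ.+-identityʳ n)) (sym (ℕ.n≡⌈n+n/2⌉ n))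

theorem1p5 : ((k : ℕ) → 1 ≤ k → Φ (wPerm (2 ℕ.* k)) ≡ catalan (k ℕ.∸ 1) ℕ.* catalan (k ℕ.∸ 1))
    × ((k : ℕ) → 1 ≤ k → Φ (wPerm (2 ℕ.* k ℕ.+ 1)) ≡ catalan (k ℕ.∸ 1) ℕ.* catalan k)
theorem1p5 = even , odd
  where
  even : (k : ℕ) → 1 ≤ k → Φ (wPerm (2 ℕ.* k)) ≡ catalan (k ℕ.∸ 1) ℕ.* catalan (k ℕ.∸ 1)
  even (suc i) _ = begin
    Φ (wPerm (2 ℕ.* suc i))                            ≡⟨ cong (Φ ∘ wPerm) (ℕ.*-suc 2 i) ⟩
    Φ (wPerm (2 ℕ.+ 2 ℕ.* i))                          ≡⟨ Φ-wPerm (2 ℕ.* i) ⟩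
    catalan ⌊ suc (2 ℕ.* i) /2⌋ ℕ.* catalan ⌊ 2 ℕ.* i /2⌋
      ≡⟨ cong₂ (λ x y → catalan x ℕ.* catalan y) (⌊1+2*n/2⌋≡n i) (⌊2*n/2⌋≡n i) ⟩
    catalan i ℕ.* catalan i ∎
  odd : (k : ℕ) → 1 ≤ k → Φ (wPerm (2 ℕ.* k ℕ.+ 1)) ≡ catalan (k ℕ.∸ 1) ℕ.* catalan k
  odd (suc i) _ = begin
    Φ (wPerm (2 ℕ.* suc i ℕ.+ 1))
      ≡⟨ cong (Φ ∘ wPerm) (trans (ℕ.+-comm (2 ℕ.* suc i) 1) (cong suc (ℕ.*-suc 2 i))) ⟩
    Φ (wPerm (2 ℕ.+ suc (2 ℕ.* i)))                    ≡⟨ Φ-wPerm (suc (2 ℕ.* i)) ⟩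
    catalan (suc ⌊ 2 ℕ.* i /2⌋) ℕ.* catalan ⌊ suc (2 ℕ.* i) /2⌋
      ≡⟨ cong₂ (λ x y → catalan (suc x) ℕ.* catalan y) (⌊2*n/2⌋≡n i) (⌊1+2*n/2⌋≡n i) ⟩
    catalan (suc i) ℕ.* catalan i                      ≡⟨ ℕ.*-comm (catalan (suc i)) (catalan i) ⟩
    catalan i ℕ.* catalan (suc i) ∎
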